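{- Let $t,k\in\mathbb{Z}^+$. Then there exists a constant $\delta=\delta(t,k)$ (depending only on $t$ and $k$) such that for every connected graph $G$ with no $K_{2,t}$-minor and with $\mathrm{diam}(G)\ge 4k$, the distributed algorithm DomSet (in the LOCAL model) finds in $O(k)$ rounds a distance-$k$ dominating set $D$ in $G$ such that $|D|\le \delta\cdot\gamma_k(G)$.
   Context: Graphs are finite and simple. $K_{2,t}$ is the complete bipartite graph with parts of sizes $2$ and $t$. A graph $G$ has an $H$-minor if $H$ can be obtained from a subgraph of $G$ by a sequence of edge contractions (discarding loops and parallel edges). $d_G(u,v)$ is the length of a shortest $u,v$-path in $G$, and $N^k[v]$ is the set of vertices within distance at most $k$ of $v$ in $G$ (including $v$). A set $D\subseteq V(G)$ is a distance-$k$ dominating set if every vertex of $G$ is within distance at most $k$ of some vertex of $D$; $\gamma_k(G)$ is the minimum size of a distance-$k$ dominating set in $G$. LOCAL model (standard deterministic LOCAL model): vertices of $G$ are computational units with unique identifiers $ID(v)$; computation proceeds in synchronized rounds, and in each round every vertex can send messages to and receive messages from its neighbors (of unbounded size) and perform arbitrary individual computations. Algorithm DomSet (input $G=(V,E)$, parameter $k$): (1) every $v\in V$ computes, in parallel, $q_v=|N^k[v]|$; (2) every $v\in V$ selects the vertex $w_v\in N^k[v]$ for which $q_{w_v}$ is maximum among all vertices in $N^k[v]$ and, subject to this, $ID(w_v)$ is maximum; (3) the output is $D:=\{w_v : v\in V\}$. -}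

module Defs where

open import Data.Bool using (Bool; false; T; T?; _xor_)
open import Data.Bool.Properties using (xor-comm; xor-same)
open import Data.Fin using (Fin; splitAt)
open import Data.Fin.Properties using (all?; any?; _≟_)
open import Data.Fin.Subset using (Subset; ⊤; ⁅_⁆; ⋃; ∣_∣; _∈_)
open import Data.Fin.Subset.Properties using (_∈?_; anySubset?; ∈⊤)
open import Data.List using (allFin; filter; map)
import Data.List.Extrema as Extrema
open import Data.Nat using (ℕ; zero; suc; _+_; _≤_; _<_; z≤n; s≤s)
import Data.Nat.Properties as ℕ
open import Data.Product using (Σ-syntax; ∃; ∃-syntax; ∃₂; _×_; _,_; proj₁)
open import Data.Product.Relation.Binary.Lex.NonStrict using (×-totalOrder)
open import Data.Sum using (_⊎_; isInj₁)
open import Data.Maybe using (is-just)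
open import Data.Vec as Vec using (Vec; []; _∷_)
open import Data.Vec.Relation.Unary.All using ([])
open import Data.Vec.Relation.Unary.Linked using (Linked; [-]; linked?)
open import Data.Vec.Relation.Unary.Unique.Propositional using (Unique)
open import Data.Vec.Relation.Unary.AllPairs using ([]; _∷_; allPairs?)
open import Function using (_∘_; Injective; Surjective; _⇔_)
open import Relation.Binary.Construct.Closure.ReflexiveTransitive using (Star)
open import Relation.Binary.PropositionalEquality using (_≡_; _≢_; refl; sym; subst)
open import Relation.Nullary using (Dec; yes; no; does; ¬?)
open import Relation.Nullary.Decidable using (map′; _×-dec_)
open import Relation.Unary using (Pred; Decidable)
open import Level using (0ℓ)

private
  variable
    m n : ℕ

IsLeast : Pred ℕ 0ℓ → Pred ℕ 0ℓ
IsLeast P m = P m × (∀ {j} → P j → m ≤ j)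

least : {P : Pred ℕ 0ℓ} → Decidable P → ∃ P → ∃ (IsLeast P)
least {P} P? (b , Pb) = go b 0 (subst P (sym (ℕ.+-identityʳ b)) Pb) (λ _ → z≤n)
  where
  go : ∀ fuel lo → P (fuel + lo) → (∀ {j} → P j → lo ≤ j) → ∃ (IsLeast P)
  go zero       lo p lb = lo , p , lb
  go (suc fuel) lo p lb with P? lo
  ... | yes q = lo , q , lb
  ... | no ¬q = go fuel (suc lo) (subst P (sym (ℕ.+-suc fuel lo)) p)
                  (λ Pj → ℕ.≤∧≢⇒< (lb Pj) (λ { refl → ¬q Pj }))

record Graph (n : ℕ) : Set where
  field
    edge        : Fin n → Fin n → Bool
    symmetric   : ∀ u v → edge u v ≡ edge v u
    irreflexive : ∀ v → edge v v ≡ false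

  Adj : Fin n → Fin n → Set
  Adj u v = T (edge u v)

  Adj-sym : ∀ {u v} → Adj u v → Adj v u
  Adj-sym {u} {v} = subst T (symmetric u v)

open Graph public using (Adj; Adj-sym)

-- The complete bipartite graph; its parts are the first a and the last b
-- vertices.
K : (a b : ℕ) → Graph (a + b)
K a b = record
  { edge        = λ x y → left x xor left y
  ; symmetric   = λ x y → xor-comm (left x) (left y)
  ; irreflexive = λ x → xor-same (left x)
  }
  where
  left : Fin (a + b) → Bool
  left = is-just ∘ isInj₁ ∘ splitAt a

-- S is isomorphic to a (not necessarily induced) subgraph of G.
record _⊑_ (S : Graph m) (G : Graph n) : Set where
  field
    embed     : Fin m → Fin n
    injective : Injective _≡_ _≡_ embed
    preserves : ∀ {x y} → Adj S x y → Adj G (embed x) (embed y)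

-- H is, up to isomorphism, the simple graph G / uv for some edge uv of G:
-- π merges u with v and is otherwise one-to-one.
record Contraction (G : Graph n) (H : Graph m) : Set where
  field
    u v        : Fin n
    uv-edge    : Adj G u v
    π          : Fin n → Fin m
    surjective : Surjective _≡_ _≡_ π
    fibres     : ∀ x y → π x ≡ π y ⇔ (x ≡ y ⊎ (x ≡ u × y ≡ v) ⊎ (x ≡ v × y ≡ u))
    adjacency  : ∀ a b → Adj H a b ⇔
                   (a ≢ b × ∃₂ λ x y → π x ≡ a × π y ≡ b × Adj G x y)

_↝_ : ∃ Graph → ∃ Graph → Set
(_ , G) ↝ (_ , H) = Contraction G H

HasMinor : Graph n → Graph m → Set
HasMinor G H = ∃[ s ] Σ[ S ∈ Graph s ] S ⊑ G × Star _↝_ (s , S) (_ , H)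

module _ (G : Graph n) where

  record IsPath (u v : Fin n) (d : ℕ) (xs : Vec (Fin n) (suc d)) : Set where
    constructor isPath
    field
      starts   : Vec.head xs ≡ u
      ends     : Vec.last xs ≡ v
      linked   : Linked (Adj G) xs
      distinct : Unique xs

  Path : Fin n → Fin n → ℕ → Set
  Path u v d = ∃ (IsPath u v d)

  Connected : Set
  Connected = ∀ u v → ∃ (Path u v)

  Distance : Fin n → Fin n → ℕ → Set
  Distance u v = IsLeast (Path u v)

  Diameter : ℕ → Set
  Diameter m = (∃₂ λ u v → Distance u v m) × (∀ {u v d} → Distance u v d → d ≤ m)

  Within : ℕ → Fin n → Fin n → Set
  Within k u v = ∃[ d ] Distance u v d × d ≤ k

  isPath? : ∀ u v d → Decidable (IsPath u v d)
  isPath? u v d xs = map′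
    (λ (a , b , c , e) → isPath a b c e)
    (λ (isPath a b c e) → a , b , c , e)
    (Vec.head xs ≟ u ×-dec Vec.last xs ≟ v ×-dec
     linked? (λ x y → T? (Graph.edge G x y)) xs ×-dec allPairs? (λ x y → ¬? (x ≟ y)) xs)

  anyVec? : ∀ {l} {P : Pred (Vec (Fin n) l) 0ℓ} → Decidable P → Dec (∃ P)
  anyVec? {zero}  P? = map′ ([] ,_) (λ { ([] , p) → p }) (P? [])
  anyVec? {suc l} P? = map′
    (λ (x , xs , p) → x ∷ xs , p)
    (λ { (x ∷ xs , p) → x , xs , p })
    (any? λ x → anyVec? (P? ∘ (x ∷_)))

  path? : ∀ u v → Decidable (Path u v)
  path? u v d = anyVec? (isPath? u v d)

  within? : ∀ k u v → Dec (Within k u v)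
  within? k u v = map′ to from (ℕ.anyUpTo? (path? u v) (suc k))
    where
    to : (∃[ d ] d < suc k × Path u v d) → Within k u v
    to (d , d<1+k , p) with least (path? u v) (d , p)
    ... | e , q , lb = e , (q , lb) , ℕ.≤-trans (lb p) (ℕ.m<1+n⇒m≤n d<1+k)

    from : Within k u v → ∃[ d ] d < suc k × Path u v d
    from (d , (p , _) , d≤k) = d , s≤s d≤k , p

  within-refl : ∀ k v → Within k v v
  within-refl k v = 0 , ((v ∷ [] , isPath refl refl [-] ([] ∷ [])) , λ _ → z≤n) , z≤n

  N[_] : ℕ → Fin n → Subset n
  N[ k ] v = Vec.tabulate (does ∘ within? k v)

  Dominating : ℕ → Subset n → Set
  Dominating k D = ∀ v → ∃[ u ] u ∈ D × Within k v u

  dominating? : ∀ k → Decidable (Dominating k)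
  dominating? k D = all? λ v → any? λ u → u ∈? D ×-dec within? k v u

  DominatingOfSize : ℕ → ℕ → Set
  DominatingOfSize k s = ∃[ D ] Dominating k D × ∣ D ∣ ≡ s

  minimumDominating : ∀ k → ∃ (IsLeast (DominatingOfSize k))
  minimumDominating k = least
    (λ s → anySubset? λ D → dominating? k D ×-dec ∣ D ∣ ℕ.≟ s)
    (_ , ⊤ , (λ v → v , ∈⊤ , within-refl k v) , refl)

  γ : ℕ → ℕ
  γ k = proj₁ (minimumDominating k)

module DomSet (k : ℕ) (G : Graph n) (ID : Fin n → ℕ) where

  q : Fin n → ℕ
  q v = ∣ N[_] G k v ∣

  -- Lexicographic order: compare q first and break ties by ID.
  open Extrema (×-totalOrder ℕ.≤-decTotalOrder ℕ.≤-totalOrder) using (argmax)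

  -- The default value v is itself an element of N[ k ] v.
  w : Fin n → Fin n
  w v = argmax (λ u → q u , ID u) v (filter (_∈? N[_] G k v) (allFin n))

  D : Subset n
  D = ⋃ (map (⁅_⁆ ∘ w) (allFin n))

-- A vertex starts with its degree and identifier only, addresses its
-- neighbours through ports numbered below its degree, and in each round
-- sends one message through, and receives one message from, every port.
record LocalAlgorithm (Out : Set) : Set₁ where
  field
    State   : (deg : ℕ) → Set
    Message : Set
    init    : ∀ deg (id : ℕ) → State deg
    send    : ∀ {deg} → State deg → Fin deg → Message
    receive : ∀ {deg} → State deg → (Fin deg → Message) → State deg
    rounds  : ℕ
    output  : ∀ {deg} → State deg → Out

record Network (G : Graph n) : Set where
  field
    ID           : Fin n → ℕ
    ID-injective : Injective _≡_ _≡_ ID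
    degree       : Fin n → ℕ
    nbr          : ∀ v → Fin (degree v) → Fin n
    nbr-inj      : ∀ v → Injective _≡_ _≡_ (nbr v)
    nbr-adj      : ∀ v i → Adj G v (nbr v i)
    port         : ∀ {v u} → Adj G v u → Fin (degree v)
    nbr-port     : ∀ {v u} (e : Adj G v u) → nbr v (port e) ≡ u

module _ {Out : Set} (A : LocalAlgorithm Out) {G : Graph n} (net : Network G) where
  open LocalAlgorithm A
  open Network net

  stateAfter : ℕ → (v : Fin n) → State (degree v)
  stateAfter zero    v = init (degree v) (ID v)
  stateAfter (suc r) v = receive (stateAfter r v) λ i →
    send (stateAfter r (nbr v i)) (port (Adj-sym G (nbr-adj v i)))

  run : Fin n → Out
  run v = output (stateAfter rounds v)

-- What each vertex v has determined when DomSet ends: q_v, the identifier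
-- of w_v, and whether v itself belongs to D.
record Result : Set where
  constructor result
  field
    ballSize   : ℕ
    selectedID : ℕ
    inD        : Bool

module _ (k : ℕ) {G : Graph n} (net : Network G) where
  open Network net using (ID)
  open DomSet k G ID

  domSetResult : Fin n → Result
  domSetResult v = result (q v) (ID (w v)) (Vec.lookup D v)

-- Let X be a minimum distance-k dominating set, and choose for every selected
-- vertex one v with w v equal to it and a path of length ≤ k from v to w v.
-- Since each v selects its maximum, u and v with w u ≠ w v cannot both see the
-- other's selection; hence every vertex lies on at most k + 1 of these paths.
-- Moreover, no vertex p (with few exceptions) separates a path from X within
-- distance 2k: if v is close to p, then w v was preferred to p, so either its
-- ball contains the ball of p, which happens for only one w v per p, or w v sees
-- a vertex z that p does not, and the way from w v via z to X avoids p.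
--
-- Growing the paths towards a set Y ⊇ X, which absorbs the grown sets whenever
-- too few of them are disjoint, and then growing them again while avoiding the
-- first point of attachment, yields disjoint connected sets, each attached to
-- two different vertices of some Y, with ∣Y∣ at most a constant times smaller.
-- Contracting such a connector together with its two ends destroys only the
-- connectors parallel to it, of which there are fewer than t without a
-- K₂,ₜ-minor; so there are at most t ∣Y∣ connectors.

module Submission where

open import Defs
open import Level using (0ℓ)
open import Data.Bool using (true; false; T; if_then_else_)
open import Data.Fin using (Fin; zero; suc; splitAt; join; inject≤; punchIn; punchOut)
import Data.Fin as Fin
open import Data.Fin.Properties
  using (_≟_; any?; all?; <-cmp; pigeonhole; suc-injective; inject≤-injective; join-splitAt;
         punchOut-cong; punchOut-injective; punchOut-punchIn; punchIn-punchOut; punchInᵢ≢i)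
open import Data.Fin.Subset using (Subset; inside; outside; ⁅_⁆; ⋃; ∣_∣; _⊆_)
  renaming (_∈_ to _∈ₛ_; _∉_ to _∉ₛ_)
open import Data.Fin.Subset.Properties
  using (x∈p∪q⁻; x∈p∪q⁺; ∉⊥; x∈⁅x⁆; x∈⁅y⁆⇒x≡y; p⊂q⇒∣p∣<∣q∣) renaming (_∈?_ to _∈ₛ?_)
open import Data.List
  using (List; []; _∷_; [_]; _++_; length; filter; map; concat; concatMap; lookup; tabulate;
         upTo; allFin; cartesianProduct; deduplicate)
open import Data.List.Properties
  using (length-++; length-map; length-upTo; filter-notAll; map-tabulate; map-cong; map-∘)
import Data.List.Extrema as Extrema
open import Data.List.Membership.Propositional using (_∈_; _∉_; find; lose)
open import Data.List.Membership.Propositional.Properties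
  using (∈-lookup; ∈-++⁺ˡ; ∈-++⁺ʳ; ∈-++⁻; ∈-map⁺; ∈-map⁻; ∈-filter⁺; ∈-filter⁻;
         ∈-concatMap⁺; ∈-concatMap⁻; ∈-tabulate⁺; ∈-tabulate⁻; ∈-allFin; ∈-upTo⁺;
         ∈-cartesianProduct⁺; ∈-deduplicate⁺; ∈-deduplicate⁻)
open import Data.List.Relation.Binary.Disjoint.Propositional using (Disjoint)
open import Data.List.Relation.Unary.All as All using (All; []; _∷_)
import Data.List.Relation.Unary.All.Properties as All
open import Data.List.Relation.Unary.AllPairs as AllPairs using (AllPairs; []; _∷_)
import Data.List.Relation.Unary.AllPairs.Properties as AllPairs
open import Data.List.Relation.Unary.Any as Any using (Any; here; there; index)
open import Data.List.Relation.Unary.Any.Properties using (lookup-index)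
open import Data.List.Relation.Unary.Unique.Propositional using (Unique)
import Data.List.Relation.Unary.Unique.Propositional.Properties as Unique
open import Data.Nat
  using (ℕ; zero; suc; _+_; _*_; _≤_; _<_; _≤?_; _<?_; z≤n; s≤s; s≤s⁻¹; NonZero)
import Data.Nat.Properties as ℕ
open import Data.Nat.Solver using (module +-*-Solver)
open import Data.Product using (Σ-syntax; ∃; ∃-syntax; ∃₂; _×_; _,_; proj₁; proj₂)
open import Data.Product.Relation.Binary.Lex.NonStrict using (×-totalOrder)
open import Data.Sum using (_⊎_; inj₁; inj₂; [_,_]′)
open import Data.Unit using (tt) renaming (⊤ to Unit)
open import Data.Vec as Vec using (Vec; []; _∷_; here; there)
open import Data.Vec.Properties using (lookup∘tabulate; []=⇒lookup; lookup⇒[]=)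
import Data.Vec.Relation.Unary.All as VAll
import Data.Vec.Relation.Unary.AllPairs as VAllPairs
import Data.Vec.Relation.Unary.Any as VAny
open import Data.Vec.Relation.Unary.Linked using (Linked; [-]; _∷_)
import Data.Vec.Relation.Unary.Unique.Propositional as VUnique
open import Function using (_∘_; Injective; _⇔_; mk⇔; module Equivalence)
open import Relation.Binary using (Rel; Decidable; TotalOrder; tri<; tri≈; tri>)
open import Relation.Binary.Construct.Closure.ReflexiveTransitive as Star using (Star; ε; _◅_; _◅◅_)
open import Relation.Binary.PropositionalEquality
  using (_≡_; _≢_; refl; sym; trans; cong; cong₂; subst; subst₂; ≢-sym)
open import Relation.Nullary using (¬_; Dec; yes; no; does; ¬?; contradiction)
open import Relation.Nullary.Decidable
  using (T?; map′; _×-dec_; _⊎-dec_; _→-dec_; dec-true; dec-false; does-⇔)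
import Relation.Unary as Unary
open import Data.List.Membership.DecPropositional ℕ._≟_ using () renaming (_∈?_ to _∈ℕ?_)
open import Data.List.Relation.Unary.Unique.DecPropositional.Properties ℕ._≟_ using (deduplicate-!)

private
  variable
    A I Y L : Set
    n h s   : ℕ

module ⇔ = Equivalence

-- Pigeonhole arguments and maximal disjoint families on lists.

AllPairs-lookup : ∀ {S : Rel A 0ℓ} {xs} → AllPairs S xs →
                  ∀ {i j} → i Fin.< j → S (lookup xs i) (lookup xs j)
AllPairs-lookup {xs = x ∷ xs} (p ∷ _)  {zero}  {suc j} _         = All.lookup p (∈-lookup j)
AllPairs-lookup {xs = x ∷ xs} (_ ∷ ps) {suc i} {suc j} (s≤s i<j) = AllPairs-lookup ps i<j

lookup-injective : ∀ {xs : List A} → Unique xs → Injective _≡_ _≡_ (lookup xs)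
lookup-injective uniq {i} {j} eq with <-cmp i j
... | tri< i<j _ _ = contradiction eq (AllPairs-lookup uniq i<j)
... | tri≈ _ i≡j _ = i≡j
... | tri> _ _ j<i = contradiction (sym eq) (AllPairs-lookup uniq j<i)

-- Each index picks one related entry of `ys`. Were there more indices than entries, two of them
-- would pick the same one, and `clash` denies them the relation that `pairs` grants.
pigeon : ∀ {S : Rel I 0ℓ} {R : I → Y → Set} {is ys} → AllPairs S is →
         All (λ i → Any (R i) ys) is →
         (∀ {i j y} → R i y → R j y → ¬ S i j) → length is ≤ length ys
pigeon {R = R} {is} {ys} pairs hits clash with length is ≤? length ys
... | yes le = le
... | no ¬le with pigeonhole (ℕ.≰⇒> ¬le) (λ i → index (All.lookup hits (∈-lookup i)))
... | i , j , i<j , eq = contradiction (AllPairs-lookup pairs i<j)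
  (clash (lookup-index (hit i))
         (subst (λ z → R (lookup is j) (lookup ys z)) (sym eq) (lookup-index (hit j))))
  where
  hit : ∀ i → Any (R (lookup is i)) ys
  hit i = All.lookup hits (∈-lookup i)

Unique-⊆⇒length≤ : ∀ {xs ys : List A} → Unique xs → (∀ {x} → x ∈ xs → x ∈ ys) →
                   length xs ≤ length ys
Unique-⊆⇒length≤ uniq sub = pigeon uniq (All.tabulate sub) (λ { refl refl x≢x → x≢x refl })

length-partition : ∀ {P : Unary.Pred A 0ℓ} (P? : Unary.Decidable P) xs →
                   length xs ≡ length (filter P? xs) + length (filter (¬? ∘ P?) xs)
length-partition P? [] = refl
length-partition P? (x ∷ xs) with P? x
... | yes _ = cong suc (length-partition P? xs)
... | no  _ = trans (cong suc (length-partition P? xs)) (sym (ℕ.+-suc _ _))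

map-proj₁-toList : ∀ {P : Unary.Pred A 0ℓ} {xs} (ps : All P xs) → map proj₁ (All.toList ps) ≡ xs
map-proj₁-toList []       = refl
map-proj₁-toList (p ∷ ps) = cong (_ ∷_) (map-proj₁-toList ps)

length-concatMap≤ : ∀ {s} (W : I → List A) is → (∀ i → length (W i) ≤ s) →
                    length (concatMap W is) ≤ length is * s
length-concatMap≤ W []       bound = z≤n
length-concatMap≤ W (i ∷ is) bound rewrite length-++ (W i) {concatMap W is} =
  ℕ.+-mono-≤ (bound i) (length-concatMap≤ W is bound)

Meets : List A → List A → Set
Meets xs ys = Any (_∈ ys) xs

meets-sym : ∀ {xs ys : List A} → Meets xs ys → Meets ys xs
meets-sym m with find m
... | _ , x∈xs , x∈ys = lose x∈ys x∈xs

-- Greedy choice from the back: an index is kept when its set misses all sets kept so far. Since the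
-- sets are nonempty, a kept index meets the union too, through its own set.
maximalDisjoint : ∀ {n} (W : I → List (Fin n)) is → (∀ i → ∃ (_∈ W i)) →
  Σ[ js ∈ List I ] AllPairs (λ i j → Disjoint (W i) (W j)) js ×
                   All (λ i → Meets (W i) (concatMap W js)) is
maximalDisjoint W []       inh = [] , [] , []
maximalDisjoint {n = n} W (i ∷ is) inh with maximalDisjoint W is inh
... | js , disj , cover with Any.any? (λ v → v ∈? concatMap W js) (W i)
  where open import Data.List.Membership.DecPropositional (_≟_ {n}) using (_∈?_)
... | yes m = js , disj , m ∷ cover
... | no ¬m = i ∷ js , All.tabulate apart ∷ disj ,
              lose (proj₂ (inh i)) (∈-++⁺ˡ (proj₂ (inh i))) ∷
              All.map (Any.map (∈-++⁺ʳ (W i))) cover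
  where
  apart : ∀ {j} → j ∈ js → Disjoint (W i) (W j)
  apart j∈js (v∈i , v∈j) = ¬m (lose v∈i (∈-concatMap⁺ W (lose j∈js v∈j)))

-- Walks and balls

module Walks {n} (G : Graph n) where

  V : Set
  V = Fin n

  open import Data.List.Membership.DecPropositional (_≟_ {n}) using (_∈?_)

  -- Walks may repeat vertices, so that they can be concatenated freely. The predicate is imposed on
  -- both ends as well.
  data Walk (P : Unary.Pred V 0ℓ) : ℕ → V → V → Set where
    stop : ∀ {v} → P v → Walk P 0 v v
    step : ∀ {l u x v} → P u → Adj G u x → Walk P l x v → Walk P (suc l) u v

  FreeWalk : ℕ → V → V → Set
  FreeWalk = Walk λ _ → Unit

  private
    variable
      P   : Unary.Pred V 0ℓ
      l m : ℕ
      u v x y z : V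

  stop′ : FreeWalk 0 v v
  stop′ = stop tt

  step′ : Adj G u x → FreeWalk l x v → FreeWalk (suc l) u v
  step′ = step tt

  _++ʷ_ : Walk P l u v → Walk P m v x → Walk P (l + m) u x
  stop _      ++ʷ w′ = w′
  step p e w ++ʷ w′ = step p e (w ++ʷ w′)

  snoc : FreeWalk l u v → Adj G v x → FreeWalk (suc l) u x
  snoc (stop _)     e = step′ e stop′
  snoc (step p a w) e = step p a (snoc w e)

  reverse : FreeWalk l u v → FreeWalk l v u
  reverse (stop _)     = stop′
  reverse (step _ e w) = snoc (reverse w) (Adj-sym G e)

  end-ok : Walk P l u v → P v
  end-ok (stop p)     = p
  end-ok (step _ _ w) = end-ok w

  -- Every vertex cuts the walk into two walks whose lengths add up to `l`. Handing these to `ok`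
  -- lets distance conditions keep a vertex off the walk.
  restrict : FreeWalk l u v →
             (∀ {a b z} → FreeWalk a u z → FreeWalk b z v → a + b ≡ l → P z) → Walk P l u v
  restrict w@(stop _)      ok = stop (ok stop′ stop′ refl)
  restrict w@(step _ e w₁) ok = step (ok stop′ w refl) e
    (restrict w₁ λ w₂ w₃ eq → ok (step′ e w₂) w₃ (cong suc eq))

  -- The last vertex is left out because a walk will end at a point of attachment, which must not
  -- belong to the grown set.
  initial : Walk P l u v → List V
  initial (stop _)             = []
  initial (step {u = u} _ _ w) = u ∷ initial w

  length-initial : (w : Walk P l u v) → length (initial w) ≡ l
  length-initial (stop _)     = refl
  length-initial (step _ _ w) = cong suc (length-initial w)

  takeUntil : (w : Walk P l u v) → z ∈ initial w → ∃[ a ] a < l × Walk P a u z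
  takeUntil (step p e w) (here refl) = 0 , s≤s z≤n , stop p
  takeUntil (step p e w) (there z∈)  with takeUntil w z∈
  ... | a , a<l , w′ = suc a , s≤s a<l , step p e w′

  truncate : ∀ Y (w : Walk P l u y) → y ∈ Y →
             ∃[ a ] a ≤ l × ∃[ y′ ] y′ ∈ Y × ∃[ w′ ] (∀ {z} → z ∈ initial {P} {a} {u} {y′} w′ → z ∉ Y)
  truncate Y w@(stop p) y∈ = 0 , z≤n , _ , y∈ , w , λ ()
  truncate {u = u} Y (step p e w) y∈ with u ∈? Y | truncate Y w y∈
  ... | yes u∈ | _ = 0 , z≤n , u , u∈ , stop p , λ ()
  ... | no u∉ | a , a≤l , y′ , y′∈ , w′ , out =
    suc a , s≤s a≤l , y′ , y′∈ , step p e w′ , λ { (here refl) → u∉ ; (there z∈) → out z∈ }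

  vertices : FreeWalk l u v → List V
  vertices {v = v} w = v ∷ initial w

  splitAt-vertex : (w : FreeWalk l u v) → z ∈ vertices w →
                   ∃[ a ] ∃[ b ] FreeWalk a u z × FreeWalk b z v × a + b ≡ l
  splitAt-vertex {l = l} w (here refl) = l , 0 , w , stop′ , ℕ.+-identityʳ l
  splitAt-vertex w@(step _ _ _) (there (here refl)) = 0 , _ , stop′ , w , refl
  splitAt-vertex (step _ e w) (there (there z∈)) with splitAt-vertex w (there z∈)
  ... | a , b , w₁ , w₂ , eq = suc a , b , step′ e w₁ , w₂ , cong suc eq

  Inside : List V → V → V → Set
  Inside W x y = Adj G x y × x ∈ W × y ∈ W

  -- Connectedness of `W` by way of a representative, which later becomes the label of the
  -- contracted set.
  Spans : V → List V → Set
  Spans r W = r ∈ W × (∀ {x} → x ∈ W → Star (Inside W) r x)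

  reaches-initial : ∀ {W} (w : Walk P l u v) → (∀ {x} → x ∈ initial w → x ∈ W) →
                    x ∈ initial w → Star (Inside W) u x
  reaches-initial (step _ e w) sub (here refl) = ε
  reaches-initial (step _ e w@(step _ _ _)) sub (there x∈) =
    (e , sub (here refl) , sub (there (here refl))) ◅ reaches-initial w (λ z → sub (there z)) x∈

  spans-++ : ∀ {r B} → Spans r B → u ∈ B → (w : Walk P l u v) → Spans r (B ++ initial w)
  spans-++ {u = u} {r = r} {B} (r∈ , conn) u∈ w = ∈-++⁺ˡ r∈ , reach
    where
    inB : ∀ {x} → x ∈ B → Star (Inside (B ++ initial w)) r x
    inB x∈ = Star.map (λ (e , p , q) → e , ∈-++⁺ˡ p , ∈-++⁺ˡ q) (conn x∈)
    reach : ∀ {x} → x ∈ B ++ initial w → Star (Inside (B ++ initial w)) r x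
    reach x∈ with ∈-++⁻ B x∈
    ... | inj₁ x∈B = inB x∈B
    ... | inj₂ x∈w = inB u∈ ◅◅ reaches-initial w (∈-++⁺ʳ B) x∈w

  last-edge : (w : Walk P l u v) → u ≡ v ⊎ ∃[ z ] z ∈ initial w × Adj G z v
  last-edge (stop _)                = inj₁ refl
  last-edge (step {u = u} _ e w) with last-edge w
  ... | inj₁ refl          = inj₂ (u , here refl , e)
  ... | inj₂ (z , z∈ , e′) = inj₂ (z , there z∈ , e′)

  Ball : ℕ → V → V → Set
  Ball k u v = ∃[ l ] l ≤ k × FreeWalk l u v

  ball-sym : ∀ {k} → Ball k u v → Ball k v u
  ball-sym (l , l≤k , w) = l , l≤k , reverse w

  path⇒walk : ∀ {d} → Path G u v d → FreeWalk d u v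
  path⇒walk (xs , isPath refl refl lk _) = go xs lk
    where
    go : ∀ {d} (xs : Vec V (suc d)) → Linked (Adj G) xs → FreeWalk d (Vec.head xs) (Vec.last xs)
    go (x ∷ [])     _        = stop′
    go (x ∷ y ∷ xs) (e ∷ lk) = step′ e (go (y ∷ xs) lk)

  -- If `u` already lies on the path, the part from `u` on is taken instead; it is no longer than
  -- the path.
  prependPath : ∀ {d} → Adj G u x → Path G x v d → ∃[ e ] e ≤ suc d × Path G u v e
  prependPath {u} {x} {v} e (xs , isPath refl refl lk un) with VAny.any? (u ≟_) xs
  ... | no u∉ = _ , ℕ.≤-refl , u ∷ xs ,
                isPath refl refl (cons xs e lk) (apart xs u∉ VAllPairs.∷ un)
    where
    apart : ∀ {d} (xs : Vec V d) → ¬ VAny.Any (u ≡_) xs → VAll.All (u ≢_) xs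
    apart []       u∉ = VAll.[]
    apart (x ∷ xs) u∉ = (λ eq → u∉ (VAny.here eq)) VAll.∷ apart xs (λ u∈ → u∉ (VAny.there u∈))
    cons : ∀ {d} (xs : Vec V (suc d)) → Adj G u (Vec.head xs) → Linked (Adj G) xs → Linked (Adj G) (u ∷ xs)
    cons (_ ∷ _) e lk = e ∷ lk
  ... | yes u∈ with suffix xs u∈ lk un
    where
    suffix : ∀ {d} (xs : Vec V (suc d)) → VAny.Any (u ≡_) xs → Linked (Adj G) xs → VUnique.Unique xs →
             ∃[ e ] e ≤ d × Path G u (Vec.last xs) e
    suffix xs@(_ ∷ _) (VAny.here refl) lk un = _ , ℕ.≤-refl , xs , isPath refl refl lk un
    suffix (_ ∷ xs@(_ ∷ _)) (VAny.there u∈) (_ ∷ lk) (_ VAllPairs.∷ un) with suffix xs u∈ lk un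
    ... | e , e≤d , p = e , ℕ.m≤n⇒m≤1+n e≤d , p
  ... | e′ , e′≤d , p = e′ , ℕ.m≤n⇒m≤1+n e′≤d , p

  walk⇒path : FreeWalk l u v → ∃[ d ] d ≤ l × Path G u v d
  walk⇒path (stop {v} _) = 0 , z≤n , v ∷ [] , isPath refl refl [-] (VAll.[] VAllPairs.∷ VAllPairs.[])
  walk⇒path (step _ e w) with walk⇒path w
  ... | d , d≤l , p with prependPath e p
  ... | d′ , d′≤ , q = d′ , ℕ.≤-trans d′≤ (s≤s d≤l) , q

  within⇒ball : ∀ {k} → Within G k u v → Ball k u v
  within⇒ball (d , (p , _) , d≤k) = d , d≤k , path⇒walk p

  ball⇒within : ∀ {k} → Ball k u v → Within G k u v
  ball⇒within {u} {v} (l , l≤k , w) with walk⇒path w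
  ... | d , d≤l , p with least (path? G u v) (d , p)
  ... | m , m-least@(_ , lb) = m , m-least , ℕ.≤-trans (lb p) (ℕ.≤-trans d≤l l≤k)

-- Growing disjoint connected sets

-- The recurrence of `family-bound`: at most `m` indices per vertex of `Y` are settled at once, and
-- the others are counted with walks one step shorter against a set at most `1 + A * s` times as
-- large as `Y`.
growthBound : (m A s r : ℕ) → ℕ
growthBound m A s zero    = m
growthBound m A s (suc r) = m + growthBound m A s r * (1 + A * s)

module Growing {n} (G : Graph n) where
  open Walks G
  open import Data.List.Membership.DecPropositional (_≟_ {n}) using (_∈?_)

  -- Only vertices satisfying Ok i may be used to extend or attach set i.
  record Family (Ix : Set) : Set₁ where
    field
      root     : Ix → V
      set      : Ix → List V
      spans    : ∀ i → Spans (root i) (set i)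
      Ok       : Ix → V → Set
      Distinct : Rel Ix 0ℓ
      m        : ℕ
      hits     : ∀ {is} Y → AllPairs Distinct is → All (λ i → Meets (set i) Y) is →
                 length is ≤ m * length Y

  module _ {Ix : Set} (F : Family Ix) where
    open Family F

    record Grown (s : ℕ) (Y : List V) (i : Ix) : Set where
      field
        grown    : List V
        size     : length grown ≤ s
        contains : ∀ {v} → v ∈ set i → v ∈ grown
        spanned  : Spans (root i) grown
        avoids   : Disjoint grown Y
        target   : V
        target∈  : target ∈ Y
        target-ok : Ok i target
        source   : V
        source∈  : source ∈ grown
        attached : Adj G source target

    open Grown public

    Apart : ∀ {s Y} → Rel (∃ (Grown s Y)) 0ℓ
    Apart (_ , g) (_ , h) = Disjoint (grown g) (grown h)

    Reach : ℕ → List V → Ix → Set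
    Reach r Y i = ∃[ b ] b ∈ set i × ∃[ y ] y ∈ Y × ∃[ l ] l ≤ r × Walk (Ok i) l b y

    private
      record Cut (r : ℕ) (Y : List V) (i : Ix) : Set where
        field
          off     : ¬ Meets (set i) Y
          {b y}   : V
          b∈      : b ∈ set i
          y∈      : y ∈ Y
          {l}     : ℕ
          l≤r     : l ≤ r
          walk    : Walk (Ok i) l b y
          off-w   : ∀ {z} → z ∈ initial walk → z ∉ Y

        cutSet : List V
        cutSet = set i ++ initial walk

      open Cut

      cut : ∀ {r Y i} → ¬ Meets (set i) Y → Reach r Y i → Cut r Y i
      cut {Y = Y} off (b , b∈ , y , y∈ , l , l≤r , w) with truncate Y w y∈
      ... | a , a≤l , y′ , y′∈ , w′ , off-w = record
        { off = off ; b∈ = b∈ ; y∈ = y′∈ ; l≤r = ℕ.≤-trans a≤l l≤r ; walk = w′ ; off-w = off-w }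

      length-cutSet : ∀ {s r Y i} → length (set i) + r ≤ s → (c : Cut r Y i) → length (cutSet c) ≤ s
      length-cutSet {i = i} bound c
        rewrite length-++ (set i) {initial (walk c)} | length-initial (walk c) =
        ℕ.≤-trans (ℕ.+-monoʳ-≤ (length (set i)) (l≤r c)) bound

      attachment : ∀ {r Y i} (c : Cut r Y i) → ∃[ z ] z ∈ initial (walk c) × Adj G z (y c)
      attachment c with last-edge (walk c)
      ... | inj₁ refl  = contradiction (lose (b∈ c) (y∈ c)) (off c)
      ... | inj₂ found = found

      grow : ∀ {s r Y i} → length (set i) + r ≤ s → Cut r Y i → Grown s Y i
      grow {Y = Y} {i} bound c = record
        { grown = cutSet c
        ; size = length-cutSet bound c
        ; contains = ∈-++⁺ˡ
        ; spanned = spans-++ (spans i) (b∈ c) (walk c)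
        ; avoids = disjoint
        ; target = y c ; target∈ = y∈ c ; target-ok = end-ok (walk c)
        ; source = proj₁ (attachment c)
        ; source∈ = ∈-++⁺ʳ (set i) (proj₁ (proj₂ (attachment c)))
        ; attached = proj₂ (proj₂ (attachment c))
        }
        where
        disjoint : Disjoint (cutSet c) Y
        disjoint (v∈ , v∈Y) with ∈-++⁻ (set i) v∈
        ... | inj₁ v∈set = off c (lose v∈set v∈Y)
        ... | inj₂ v∈w   = off-w c v∈w v∈Y

      -- A meeting point in the initial part of the walk is not its end, so stopping there saves at
      -- least one step; this drives the induction in `family-bound`.
      shorten : ∀ {r Y Z i} (c : Cut (suc r) Y i) → Meets (cutSet c) Z →
                Meets (set i) (Y ++ Z) ⊎ Reach r (Y ++ Z) i
      shorten {Y = Y} {i = i} c meets with find meets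
      ... | z , z∈ , z∈Z with ∈-++⁻ (set i) z∈
      ... | inj₁ z∈set = inj₁ (lose z∈set (∈-++⁺ʳ Y z∈Z))
      ... | inj₂ z∈w with takeUntil (walk c) z∈w
      ... | a , a<l , w = inj₂ (b c , b∈ c , z , ∈-++⁺ʳ Y z∈Z , a ,
                                ℕ.m<1+n⇒m≤n (ℕ.≤-trans a<l (l≤r c)) , w)

    -- A maximal disjoint family of cut walks is small by assumption, so its
    -- union can be added to Y, after which all remaining walks get shorter.
    family-bound : ∀ {A s} r Y {is} →
      (∀ i → length (set i) + r ≤ s) →
      AllPairs Distinct is →
      All (λ i → Meets (set i) Y ⊎ Reach r Y i) is →
      (∀ Z → (∀ {v} → v ∈ Y → v ∈ Z) → (gs : List (∃ (Grown s Z))) →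
         AllPairs Apart gs → length gs ≤ A * length Z) →
      length is ≤ growthBound m A s r * length Y
    family-bound zero Y {is} size distinct reach small = hits Y distinct (All.map meets reach)
      where
      meets : ∀ {i} → Meets (set i) Y ⊎ Reach 0 Y i → Meets (set i) Y
      meets (inj₁ h)                                       = h
      meets (inj₂ (b , b∈ , _ , y∈ , _ , z≤n , stop _)) = lose b∈ y∈
    family-bound {A} {s} (suc r) Y {is} size distinct reach small = begin
      length is                          ≡⟨ length-partition meets? is ⟩
      length (filter meets? is) + length rest
        ≤⟨ ℕ.+-mono-≤ (hits Y (AllPairs.filter⁺ meets? distinct) (All.all-filter meets? is)) rest-bound ⟩
      m * length Y + C * length Z        ≤⟨ ℕ.+-monoʳ-≤ (m * length Y) (ℕ.*-monoʳ-≤ C Z-bound) ⟩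
      m * length Y + C * (length Y + A * length Y * s)
        ≡⟨ solve 5 (λ m C A s y → m :* y :+ C :* (y :+ A :* y :* s) :=
                                  (m :+ C :* (con 1 :+ A :* s)) :* y) refl m C A s (length Y) ⟩
      (m + C * (1 + A * s)) * length Y   ∎
      where
      open ℕ.≤-Reasoning
      open +-*-Solver
      C = growthBound m A s r
      meets? = λ i → Any.any? (_∈? Y) (set i)
      rest = filter (¬? ∘ meets?) is

      cuts : All (Cut (suc r) Y) rest
      cuts = All.zipWith (λ { (off , inj₁ h) → contradiction h off ; (off , inj₂ w) → cut off w })
               (All.all-filter (¬? ∘ meets?) is , All.filter⁺ (¬? ∘ meets?) reach)

      W : ∃ (Cut (suc r) Y) → List V
      W = cutSet ∘ proj₂

      packing = maximalDisjoint W (All.toList cuts)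
                  (λ (i , c) → root i , ∈-++⁺ˡ (proj₁ (spans i)))
      js = proj₁ packing
      Z = Y ++ concatMap W js

      -- The kept cut sets are disjoint grown sets, so `small` limits their number.
      gs : List (∃ (Grown s Y))
      gs = map (λ (i , c) → i , grow (size i) c) js

      js-bound : length js ≤ A * length Y
      js-bound = subst (_≤ A * length Y) (length-map _ js)
        (small Y (λ v∈ → v∈) gs (AllPairs.map⁺ (proj₁ (proj₂ packing))))

      Z-bound : length Z ≤ length Y + A * length Y * s
      Z-bound rewrite length-++ Y {concatMap W js} = ℕ.+-monoʳ-≤ (length Y)
        (ℕ.≤-trans (length-concatMap≤ W js (λ (i , c) → length-cutSet (size i) c))
                 (ℕ.*-monoˡ-≤ s js-bound))

      rest-reach : All (λ i → Meets (set i) Z ⊎ Reach r Z i) rest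
      rest-reach = subst (All _) (map-proj₁-toList cuts)
        (All.map⁺ (All.map (λ { {_ , c} → shorten c }) (proj₂ (proj₂ packing))))

      rest-bound : length rest ≤ C * length Z
      rest-bound = family-bound r Z
        (λ i → ℕ.≤-trans (ℕ.+-monoʳ-≤ (length (set i)) (ℕ.<⇒≤ ℕ.≤-refl)) (size i))
        (AllPairs.filter⁺ (¬? ∘ meets?) distinct) rest-reach
        (λ X Z⊆X → small X (Z⊆X ∘ ∈-++⁺ˡ))

-- Minors from labellings with connected fibres

SameFibre : Graph n → (Fin n → L) → Rel (Fin n) 0ℓ
SameFibre G c x y = Adj G x y × c x ≡ c y

-- A labelling stands for a partly contracted graph: each fibre is a set of vertices to be
-- contracted into one.
FibreConnected : Graph n → (Fin n → L) → Set
FibreConnected G c = ∀ {u v} → c u ≡ c v → Star (SameFibre G c) u v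

Touch : Graph n → (Fin n → L) → L → L → Set
Touch G c α β = ∃₂ λ x y → c x ≡ α × c y ≡ β × Adj G x y

graphOf : {_~_ : Rel (Fin n) 0ℓ} → Decidable _~_ →
          (∀ {u v} → u ~ v → v ~ u) → (∀ v → ¬ v ~ v) → Graph n
graphOf ~? sym~ irr = record
  { edge        = λ u v → does (~? u v)
  ; symmetric   = λ u v → does-⇔ (mk⇔ sym~ sym~) (~? u v) (~? v u)
  ; irreflexive = λ v → dec-false (~? v v) (irr v)
  }

T-does : ∀ {A : Set} (d : Dec A) → T (does d) ⇔ A
T-does (yes a) = mk⇔ (λ _ → a) (λ _ → _)
T-does (no ¬a) = mk⇔ (λ ()) ¬a

adj? : (G : Graph n) → Decidable (Adj G)
adj? G u v = T? (Graph.edge G u v)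

adj-irrefl : (G : Graph n) → ∀ {u v} → Adj G u v → u ≢ v
adj-irrefl G {u} e refl with Graph.edge G u u | Graph.irreflexive G u
... | false | refl = e

record IsQuotient (S : Graph s) (H : Graph h) (φ : Fin s → Fin h) : Set where
  field
    onto      : ∀ a → ∃[ x ] φ x ≡ a
    connected : FibreConnected S φ
    adjacency : ∀ a b → Adj H a b ⇔ (a ≢ b × Touch S φ a b)

collision? : (φ : Fin s → Fin h) → Dec (∃₂ λ x y → x ≢ y × φ x ≡ φ y)
collision? φ = any? λ x → any? λ y → ¬? (x ≟ y) ×-dec (φ x ≟ φ y)

¬collision⇒injective : {φ : Fin s → Fin h} → ¬ (∃₂ λ x y → x ≢ y × φ x ≡ φ y) →
                       Injective _≡_ _≡_ φ
¬collision⇒injective none {x} {y} eq with x ≟ y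
... | yes p = p
... | no  p = contradiction (x , y , p , eq) none

fibre-edge : ∀ {S : Graph s} {φ : Fin s → L} {x y} → x ≢ y → Star (SameFibre S φ) x y →
             ∃₂ λ u v → SameFibre S φ u v
fibre-edge x≢y ε       = contradiction refl x≢y
fibre-edge _   (e ◅ _) = _ , _ , e

-- One contraction inside a fibre: `v` is removed by `punchOut` and its edges pass to `u`. Since
-- both have the same image, `φ` factors through the smaller graph, whose quotient is still `H`.
module Pinch (S : Graph (suc s)) {H : Graph h} (φ : Fin (suc s) → Fin h)
             (Q : IsQuotient S H φ) (u v : Fin (suc s)) (uv : SameFibre S φ u v) where
  open IsQuotient Q

  private
    v≢u : v ≢ u
    v≢u eq = adj-irrefl S (proj₁ uv) (sym eq)

  π′ : ∀ x → Dec (v ≡ x) → Fin s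
  π′ x (yes _)  = punchOut v≢u
  π′ x (no v≢x) = punchOut v≢x

  π : Fin (suc s) → Fin s
  π x = π′ x (v ≟ x)

  φ′ : Fin s → Fin h
  φ′ = φ ∘ punchIn v

  φ′∘π : ∀ x → φ′ (π x) ≡ φ x
  φ′∘π x with v ≟ x
  ... | yes refl = trans (cong φ (punchIn-punchOut v≢u)) (proj₂ uv)
  ... | no v≢x   = cong φ (punchIn-punchOut v≢x)

  π∘punchIn : ∀ a → π (punchIn v a) ≡ a
  π∘punchIn a with v ≟ punchIn v a
  ... | yes eq = contradiction (sym eq) (punchInᵢ≢i v a)
  ... | no ne  = trans (punchOut-cong v refl) (punchOut-punchIn v)

  πu≡πv : π u ≡ π v
  πu≡πv with v ≟ u | v ≟ v
  ... | yes eq | _      = contradiction eq v≢u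
  ... | no _   | yes _  = punchOut-cong v refl
  ... | no _   | no ne  = contradiction refl ne

  π-fibres : ∀ x y → π x ≡ π y ⇔ (x ≡ y ⊎ (x ≡ u × y ≡ v) ⊎ (x ≡ v × y ≡ u))
  π-fibres x y = mk⇔ to from
    where
    to : π x ≡ π y → x ≡ y ⊎ (x ≡ u × y ≡ v) ⊎ (x ≡ v × y ≡ u)
    to eq with v ≟ x | v ≟ y
    ... | yes refl | yes refl = inj₁ refl
    ... | yes refl | no v≢y   = inj₂ (inj₂ (refl , sym (punchOut-injective v≢u v≢y eq)))
    ... | no v≢x   | yes refl = inj₂ (inj₁ (punchOut-injective v≢x v≢u eq , refl))
    ... | no v≢x   | no v≢y   = inj₁ (punchOut-injective v≢x v≢y eq)
    from : x ≡ y ⊎ (x ≡ u × y ≡ v) ⊎ (x ≡ v × y ≡ u) → π x ≡ π y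
    from (inj₁ refl)                 = refl
    from (inj₂ (inj₁ (refl , refl))) = πu≡πv
    from (inj₂ (inj₂ (refl , refl))) = sym πu≡πv

  _~_ : Rel (Fin s) 0ℓ
  a ~ b = a ≢ b × Touch S π a b

  ~? : Decidable _~_
  ~? a b = ¬? (a ≟ b) ×-dec any? λ x → any? λ y → π x ≟ a ×-dec π y ≟ b ×-dec adj? S x y

  S′ : Graph s
  S′ = graphOf ~?
    (λ (a≢b , x , y , px , py , e) → a≢b ∘ sym , y , x , py , px , Adj-sym S e)
    (λ v (v≢v , _) → v≢v refl)

  adj′ : ∀ {a b} → Adj S′ a b ⇔ a ~ b
  adj′ {a} {b} = T-does (~? a b)

  contraction : Contraction S S′
  contraction = record
    { u = u ; v = v ; uv-edge = proj₁ uv ; π = π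
    ; surjective = λ a → punchIn v a , λ { refl → π∘punchIn a }
    ; fibres = π-fibres
    ; adjacency = λ a b → adj′
    }

  step-image : ∀ {x y} → SameFibre S φ x y → Star (SameFibre S′ φ′) (π x) (π y)
  step-image {x} {y} (e , eq) with π x ≟ π y
  ... | yes p = subst (Star _ (π x)) p ε
  ... | no  p = (⇔.from adj′ (p , x , y , refl , refl , e) , trans (φ′∘π x) (trans eq (sym (φ′∘π y)))) ◅ ε

  quotient : IsQuotient S′ H φ′
  quotient = record
    { onto = λ a → let x , eq = onto a in π x , trans (φ′∘π x) eq
    ; connected = λ {a} {b} eq → at-punchIn (Star.concat (Star.gmap π step-image (connected eq)))
    ; adjacency = λ a b → mk⇔ (to a b) (from a b)
    }
    where
    at-punchIn : ∀ {a b} → Star (SameFibre S′ φ′) (π (punchIn v a)) (π (punchIn v b)) → Star (SameFibre S′ φ′) a b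
    at-punchIn {a} {b} rewrite π∘punchIn a | π∘punchIn b = λ p → p
    to : ∀ a b → Adj H a b → a ≢ b × Touch S′ φ′ a b
    to a b e with ⇔.to (adjacency a b) e
    ... | a≢b , x , y , px , py , e′ = a≢b , π x , π y , trans (φ′∘π x) px , trans (φ′∘π y) py ,
          ⇔.from adj′ ((λ eq → a≢b (trans (sym (trans (φ′∘π x) px)) (trans (cong φ′ eq) (trans (φ′∘π y) py))))
                        , x , y , refl , refl , e′)
    from : ∀ a b → a ≢ b × Touch S′ φ′ a b → Adj H a b
    from a b (a≢b , x′ , y′ , px , py , e) with ⇔.to adj′ e
    ... | _ , x , y , refl , refl , e′ = ⇔.from (adjacency a b)
          (a≢b , x , y , trans (sym (φ′∘π x)) px , trans (sym (φ′∘π y)) py , e′)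

  -- The last contraction has to end in H itself rather than in an isomorphic copy.
  contraction-onto : (∀ {a b} → φ′ a ≡ φ′ b → a ≡ b) → Contraction S H
  contraction-onto φ′-inj = record
    { u = u ; v = v ; uv-edge = proj₁ uv ; π = φ
    ; surjective = λ a → let x , eq = onto a in x , λ { refl → eq }
    ; fibres = λ x y → mk⇔
        (λ eq → ⇔.to (π-fibres x y) (φ′-inj (trans (φ′∘π x) (trans eq (sym (φ′∘π y))))))
        (λ d → trans (sym (φ′∘π x)) (trans (cong φ′ (⇔.from (π-fibres x y) d)) (φ′∘π y)))
    ; adjacency = adjacency
    }

-- Two vertices with the same image are joined inside their fibre, which supplies an edge to
-- contract, and each contraction removes a vertex. A collision is demanded at the start because an
-- injective `φ` makes `S` only isomorphic to `H`, while an empty sequence of contractions needs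
-- equality.
contractTo : (S : Graph s) {H : Graph h} (φ : Fin s → Fin h) → IsQuotient S H φ →
             (∃₂ λ x y → x ≢ y × φ x ≡ φ y) → Star _↝_ (s , S) (h , H)
contractTo {zero}  S φ Q (() , _)
contractTo {suc s} S φ Q (x , y , x≢y , eq)
  with fibre-edge {S = S} {φ = φ} x≢y (IsQuotient.connected Q eq)
... | u , v , uv with collision? (Pinch.φ′ S φ Q u v uv)
... | yes more = Pinch.contraction S φ Q u v uv ◅
                 contractTo _ _ (Pinch.quotient S φ Q u v uv) more
... | no  none = Pinch.contraction-onto S φ Q u v uv (¬collision⇒injective {φ = Pinch.φ′ S φ Q u v uv} none) ◅ ε

module Labelling (G : Graph n) (H : Graph h) (c : Fin n → Fin n) (g : Fin h → Fin n)
         (g-inj : Injective _≡_ _≡_ g) (c-conn : FibreConnected G c)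
         (inhabited : ∀ a → ∃[ v ] c v ≡ g a)
         (touching : ∀ {a b} → Adj H a b → Touch G c (g a) (g b)) where

  private
    labelled? : ∀ v → Dec (∃[ a ] g a ≡ c v)
    labelled? v = any? λ a → g a ≟ c v

    vs = filter labelled? (allFin n)

    emb : Fin (length vs) → Fin n
    emb = lookup vs

    emb-inj : Injective _≡_ _≡_ emb
    emb-inj = lookup-injective (Unique.filter⁺ labelled? (Unique.allFin⁺ n))

    label : ∀ x → ∃[ a ] g a ≡ c (emb x)
    label x = proj₂ (∈-filter⁻ labelled? {xs = allFin n} (∈-lookup x))

    φ : Fin (length vs) → Fin h
    φ = proj₁ ∘ label

    preimage : ∀ v a → g a ≡ c v → ∃[ x ] emb x ≡ v
    preimage v a eq = index v∈ , sym (lookup-index v∈)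
      where v∈ = ∈-filter⁺ labelled? (∈-allFin v) (a , eq)

    φ-emb : ∀ {x a} → c (emb x) ≡ g a → φ x ≡ a
    φ-emb {x} eq = g-inj (trans (proj₂ (label x)) eq)

    c-emb : ∀ {x y} → φ x ≡ φ y → c (emb x) ≡ c (emb y)
    c-emb {x} {y} eq = trans (sym (proj₂ (label x))) (trans (cong g eq) (proj₂ (label y)))

    -- Edges between fibres that are not adjacent in `H` are dropped, since contracting the fibres
    -- has to give exactly `H`.
    _~_ : Rel (Fin (length vs)) 0ℓ
    x ~ y = Adj G (emb x) (emb y) × (φ x ≡ φ y ⊎ Adj H (φ x) (φ y))

    ~? : Decidable _~_
    ~? x y = adj? G (emb x) (emb y) ×-dec (φ x ≟ φ y ⊎-dec adj? H (φ x) (φ y))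

    S : Graph (length vs)
    S = graphOf ~? (λ { (e , inj₁ eq) → Adj-sym G e , inj₁ (sym eq)
                      ; (e , inj₂ e′) → Adj-sym G e , inj₂ (Adj-sym H e′) })
                   (λ x (e , _) → adj-irrefl G e refl)

    adjS : ∀ {x y} → Adj S x y ⇔ x ~ y
    adjS {x} {y} = T-does (~? x y)

    S⊑G : S ⊑ G
    S⊑G = record { embed = emb ; injective = emb-inj ; preserves = proj₁ ∘ ⇔.to adjS }

    lift-star : ∀ {u v} x → emb x ≡ u → Star (SameFibre G c) u v →
                ∃[ y ] emb y ≡ v × Star (SameFibre S φ) x y
    lift-star x refl ε = x , refl , ε
    lift-star x refl (_◅_ {j = w} (e , eq) p)
      with preimage w (φ x) (trans (proj₂ (label x)) eq)
    ... | y , refl with lift-star y refl p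
    ... | z , ez , q = z , ez , (⇔.from adjS (e , inj₁ φ≡) , φ≡) ◅ q
      where φ≡ = sym (φ-emb (trans (sym eq) (sym (proj₂ (label x)))))

    quotient : IsQuotient S H φ
    quotient = record
      { onto = onto
      ; connected = λ {x} {y} eq → connected (lift-star x refl (c-conn (c-emb eq)))
      ; adjacency = λ a b → mk⇔ to from
      }
      where
      onto : ∀ a → ∃[ x ] φ x ≡ a
      onto a with inhabited a
      ... | v , eq with preimage v a (sym eq)
      ... | x , refl = x , φ-emb eq
      connected : ∀ {x y} → (∃[ z ] emb z ≡ emb y × Star (SameFibre S φ) x z) → Star (SameFibre S φ) x y
      connected (z , ez , p) with emb-inj ez
      ... | refl = p
      to : ∀ {a b} → Adj H a b → a ≢ b × Touch S φ a b
      to {a} {b} e with touching e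
      ... | u , v , cu , cv , e′ with preimage u a (sym cu) | preimage v b (sym cv)
      ... | x , refl | y , refl with φ-emb {x} cu | φ-emb {y} cv
      ... | refl | refl = adj-irrefl H e , x , y , refl , refl , ⇔.from adjS (e′ , inj₂ e)
      from : ∀ {a b} → a ≢ b × Touch S φ a b → Adj H a b
      from (a≢b , x , y , refl , refl , e) with proj₂ (⇔.to adjS e)
      ... | inj₁ eq = contradiction eq a≢b
      ... | inj₂ e′ = e′

    module Q = IsQuotient quotient

  labelling⇒minor : HasMinor G H
  labelling⇒minor with collision? φ
  ... | yes more = _ , S , S⊑G , contractTo S φ quotient more
  -- With nothing to contract, `H` itself rather than its copy `S` has to be the subgraph.
  ... | no  none = _ , H , H⊑G , ε
    where
    section : ∀ a → ∃[ x ] φ x ≡ a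
    section = Q.onto
    preserves : ∀ {a b} → Adj H a b → Adj G (emb (proj₁ (section a))) (emb (proj₁ (section b)))
    preserves {a} {b} e with ⇔.to (Q.adjacency a b) e
    ... | _ , x , y , px , py , e′
      with ¬collision⇒injective {φ = φ} none (trans (proj₂ (section a)) (sym px))
         | ¬collision⇒injective {φ = φ} none (trans (proj₂ (section b)) (sym py))
    ... | refl | refl = proj₁ (⇔.to adjS e′)
    H⊑G : H ⊑ G
    H⊑G = record
      { embed = emb ∘ proj₁ ∘ section
      ; injective = λ {a} {b} eq → trans (sym (proj₂ (section a)))
                                   (trans (cong φ (emb-inj eq)) (proj₂ (section b)))
      ; preserves = preserves
      }

-- Contracting connectors

module Connectors {n} (G : Graph n) where
  open Walks G using (V; Spans)

  private
    variable
      c : V → V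

  SameFibre-sym : ∀ {x y} → SameFibre G c x y → SameFibre G c y x
  SameFibre-sym (e , eq) = Adj-sym G e , sym eq

  touch-map : ∀ (f : V → V) {α β} → Touch G c α β → Touch G (f ∘ c) (f α) (f β)
  touch-map f (x , y , cx , cy , e) = x , y , cong f cx , cong f cy , e

  touch-sym : ∀ {α β} → Touch G c α β → Touch G c β α
  touch-sym (x , y , cx , cy , e) = y , x , cy , cx , Adj-sym G e

  merge : V → V → V → V
  merge α β x with x ≟ β
  ... | yes _ = α
  ... | no  _ = x

  merge-here : ∀ α β → merge α β β ≡ α
  merge-here α β with β ≟ β
  ... | yes _ = refl
  ... | no ne = contradiction refl ne

  merge-other : ∀ {α β x} → x ≢ β → merge α β x ≡ x
  merge-other {β = β} {x} x≢β with x ≟ β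
  ... | yes eq = contradiction eq x≢β
  ... | no _   = refl

  -- The touching edge bridges the two fibres that become one; the other fibres stay as they were.
  merge-connected : ∀ {α β} → FibreConnected G c → Touch G c α β → FibreConnected G (merge α β ∘ c)
  merge-connected {c} {α} {β} conn (p , q , cp , cq , e) {u} {v} eq = go (c u ≟ β) (c v ≟ β)
    where
    same : ∀ {x y} → c x ≡ c y → Star (SameFibre G (merge α β ∘ c)) x y
    same eq = Star.map (λ (a , b) → a , cong (merge α β) b) (conn eq)
    mp : merge α β (c p) ≡ α
    mp with c p ≟ β
    ... | yes _ = refl
    ... | no  _ = cp
    bridge : SameFibre G (merge α β ∘ c) p q
    bridge = e , trans mp (sym (trans (cong (merge α β) cq) (merge-here α β)))
    go : Dec (c u ≡ β) → Dec (c v ≡ β) → Star (SameFibre G (merge α β ∘ c)) u v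
    go (yes cu) (yes cv) = same (trans cu (sym cv))
    go (yes cu) (no cv)  = same (trans cu (sym cq)) ◅◅ SameFibre-sym bridge ◅ same
      (trans cp (trans (sym (trans (cong (merge α β) cu) (merge-here α β))) (trans eq (merge-other cv))))
    go (no cu)  (yes cv) = same
      (trans (sym (merge-other cu)) (trans eq (trans (cong (merge α β) cv) (trans (merge-here α β) (sym cp)))))
      ◅◅ bridge ◅ same (trans cq (sym cv))
    go (no cu)  (no cv)  = same (trans (sym (merge-other cu)) (trans eq (merge-other cv)))

  module _ {t} (c-conn : FibreConnected G c) {a b : V} (a≢b : a ≢ b) {js : List V}
           (unique : Unique js) (t≤ : suc t ≤ length js)
           (outside : ∀ {j} → j ∈ js → j ≢ a × j ≢ b)
           (touches : ∀ {j} → j ∈ js → Touch G c j a × Touch G c j b) where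
    private
      two : Fin 2 → V
      two zero       = a
      two (suc zero) = b

      mid : Fin (suc t) → V
      mid i = lookup js (inject≤ i t≤)

      mid∈ : ∀ i → mid i ∈ js
      mid∈ i = ∈-lookup (inject≤ i t≤)

      g′ : Fin 2 ⊎ Fin (suc t) → V
      g′ = [ two , mid ]′

      mid≢two : ∀ i x → mid i ≢ two x
      mid≢two i zero       = proj₁ (outside (mid∈ i))
      mid≢two i (suc zero) = proj₂ (outside (mid∈ i))

      g′-inj : Injective _≡_ _≡_ g′
      g′-inj {inj₁ zero}       {inj₁ zero}       eq = refl
      g′-inj {inj₁ zero}       {inj₁ (suc zero)} eq = contradiction eq a≢b
      g′-inj {inj₁ (suc zero)} {inj₁ zero}       eq = contradiction (sym eq) a≢b
      g′-inj {inj₁ (suc zero)} {inj₁ (suc zero)} eq = refl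
      g′-inj {inj₁ x} {inj₂ j} eq = contradiction (sym eq) (mid≢two j x)
      g′-inj {inj₂ i} {inj₁ y} eq = contradiction eq (mid≢two i y)
      g′-inj {inj₂ i} {inj₂ j} eq = cong inj₂ (inject≤-injective t≤ t≤ i j (lookup-injective unique eq))

      g : Fin (2 + suc t) → V
      g = g′ ∘ splitAt 2

      g-inj : Injective _≡_ _≡_ g
      g-inj {x} {y} eq = trans (sym (join-splitAt 2 _ x))
        (trans (cong (join 2 _) (g′-inj {splitAt 2 x} {splitAt 2 y} eq)) (join-splitAt 2 _ y))

      touch-mid : ∀ i x → Touch G c (mid i) (two x)
      touch-mid i zero       = proj₁ (touches (mid∈ i))
      touch-mid i (suc zero) = proj₂ (touches (mid∈ i))

      inhabited : ∀ s → ∃[ v ] c v ≡ g′ s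
      inhabited (inj₁ x) with touch-mid zero x
      ... | _ , y , _ , cy , _ = y , cy
      inhabited (inj₂ i) with touch-mid i zero
      ... | x , _ , cx , _ = x , cx

      touching : ∀ {x y} → Adj (K 2 (suc t)) x y → Touch G c (g x) (g y)
      touching {x} {y} e with splitAt 2 x | splitAt 2 y
      ... | inj₁ p | inj₂ j = touch-sym (touch-mid j p)
      ... | inj₂ i | inj₁ q = touch-mid i q

    -- The fibres of `a` and `b` form the side of size two, those of the first `suc t` entries of
    -- `js` the other side.
    parallel⇒minor : HasMinor G (K 2 (suc t))
    parallel⇒minor = Labelling.labelling⇒minor G (K 2 (suc t)) c g g-inj c-conn (inhabited ∘ splitAt 2)
      λ {x} {y} → touching {x} {y}

  -- The label of the connecting fibre, followed by the labels of its two ends.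
  Connector : Set
  Connector = V × V × V

  record Joins (c : V → V) (Y : List V) (e : Connector) : Set where
    field
      fresh   : proj₁ e ∉ Y
      left∈   : proj₁ (proj₂ e) ∈ Y
      right∈  : proj₂ (proj₂ e) ∈ Y
      apart   : proj₁ (proj₂ e) ≢ proj₂ (proj₂ e)
      touchˡ  : Touch G c (proj₁ e) (proj₁ (proj₂ e))
      touchʳ  : Touch G c (proj₁ e) (proj₂ (proj₂ e))

  open Joins

  Parallel : V → V → Connector → Set
  Parallel a b (_ , a′ , b′) = (a′ ≡ a × b′ ≡ b) ⊎ (a′ ≡ b × b′ ≡ a)

  parallel? : ∀ a b → Unary.Decidable (Parallel a b)
  parallel? a b (_ , a′ , b′) = (a′ ≟ a ×-dec b′ ≟ b) ⊎-dec (a′ ≟ b ×-dec b′ ≟ a)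

  relabel : V → V → Connector → Connector
  relabel a b (j , a′ , b′) = j , merge a b a′ , merge a b b′

  -- Contracting a connector together with one of its ends only destroys the
  -- connectors parallel to it.
  connector-bound : ∀ {t} k {Y E} → length Y ≤ k → FibreConnected G c →
                    Unique (map proj₁ E) → All (Joins c Y) E →
                    ¬ HasMinor G (K 2 (suc t)) → length E ≤ suc t * length Y
  connector-bound k {E = []} _ _ _ _ _ = z≤n
  connector-bound zero {Y = []} _ _ _ (p ∷ _) _ with () ← left∈ p
  connector-bound {c} {t} (suc k) {Y} {(i , a , b) ∷ E} len conn (i∉ ∷ unique) (p ∷ ps) ¬minor = begin
    suc (length E)                                ≡⟨ cong suc (length-partition par? E) ⟩
    suc (length (filter par? E)) + length N       ≤⟨ ℕ.+-mono-≤ few rest ⟩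
    suc t + suc t * length Y′                     ≡⟨ sym (ℕ.*-suc (suc t) (length Y′)) ⟩
    suc t * suc (length Y′)                       ≤⟨ ℕ.*-monoʳ-≤ (suc t) shorter ⟩
    suc t * length Y                              ∎
    where
    open ℕ.≤-Reasoning
    par? = parallel? a b
    N  = filter (¬? ∘ par?) E
    Y′ = filter (λ y → ¬? (y ≟ b)) Y
    -- The connector is absorbed into `a`, whose fibre then touches `b` and absorbs it as well; `Y`
    -- loses only `b`.
    c′ = merge a b ∘ merge a i ∘ c

    shorter : length Y′ < length Y
    shorter = filter-notAll _ Y (Any.map (λ eq ne → ne (sym eq)) (right∈ p))

    -- As many as `suc t` connectors parallel to the first would already form the minor with `a` and
    -- `b`. So there are at most `t`, and the first one makes `suc t`.
    few : suc (length (filter par? E)) ≤ suc t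
    few with suc t ≤? length (filter par? E)
    ... | no  t≰ = ℕ.≰⇒> t≰
    ... | yes t≤ = contradiction
      (parallel⇒minor conn (apart p) {js = map proj₁ (filter par? E)}
        (AllPairs.map⁺ (AllPairs.filter⁺ par? (AllPairs.map⁻ unique)))
        (ℕ.≤-trans t≤ (ℕ.≤-reflexive (sym (length-map proj₁ (filter par? E)))))
        (λ j∈ → proj₁ (good j∈)) (λ j∈ → proj₂ (good j∈)))
      ¬minor
      where
      good : ∀ {j} → j ∈ map proj₁ (filter par? E) →
             (j ≢ a × j ≢ b) × (Touch G c j a × Touch G c j b)
      good j∈ with ∈-map⁻ proj₁ j∈
      ... | e , e∈ , refl with ∈-filter⁻ par? {xs = E} e∈
      ... | e∈E , par with All.lookup ps e∈E
      ... | q = (avoid (left∈ p) , avoid (right∈ p)) , ends par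
        where
        avoid : ∀ {y} → y ∈ Y → proj₁ e ≢ y
        avoid y∈ refl = fresh q y∈
        ends : Parallel a b e → Touch G c (proj₁ e) a × Touch G c (proj₁ e) b
        ends (inj₁ (refl , refl)) = touchˡ q , touchʳ q
        ends (inj₂ (refl , refl)) = touchʳ q , touchˡ q

    m∈ : ∀ {y} → y ∈ Y → merge a b y ∈ Y′
    m∈ {y} y∈ with y ≟ b
    ... | yes _  = ∈-filter⁺ _ (left∈ p) (apart p)
    ... | no y≢b = ∈-filter⁺ _ y∈ y≢b

    -- Merging identifies two different ends only if they are `a` and `b`.
    m≢ : ∀ e → ¬ Parallel a b e → proj₁ (proj₂ e) ≢ proj₂ (proj₂ e) →
         merge a b (proj₁ (proj₂ e)) ≢ merge a b (proj₂ (proj₂ e))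
    m≢ (_ , x , y) ¬par x≢y with x ≟ b | y ≟ b
    ... | yes refl | yes refl = λ _ → x≢y refl
    ... | yes refl | no _     = λ { refl → ¬par (inj₂ (refl , refl)) }
    ... | no _     | yes refl = λ { refl → ¬par (inj₁ (refl , refl)) }
    ... | no _     | no _     = x≢y

    touch′ : ∀ {j y} → i ≢ j → j ∉ Y → y ∈ Y → Touch G c j y → Touch G c′ j (merge a b y)
    touch′ {j} {y} i≢j j∉ y∈ tch = subst₂ (Touch G c′)
      (trans (cong (merge a b) (merge-other {a} {i} {j} (≢-sym i≢j))) (merge-other λ { refl → j∉ (right∈ p) }))
      (cong (merge a b) (merge-other {a} {i} {y} λ { refl → fresh p y∈ }))
      (touch-map (merge a b) (touch-map (merge a i) tch))

    joins′ : ∀ {e} → e ∈ N → Joins c′ Y′ (relabel a b e)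
    joins′ {e} e∈N with ∈-filter⁻ (¬? ∘ par?) {xs = E} e∈N
    ... | e∈ , ¬par with All.lookup ps e∈ | All.lookup i∉ (∈-map⁺ proj₁ e∈)
    ... | q | i≢j = record
      { fresh = λ j∈ → fresh q (proj₁ (∈-filter⁻ _ j∈))
      ; left∈ = m∈ (left∈ q) ; right∈ = m∈ (right∈ q)
      ; apart = m≢ e ¬par (apart q)
      ; touchˡ = touch′ i≢j (fresh q) (left∈ q) (touchˡ q)
      ; touchʳ = touch′ i≢j (fresh q) (right∈ q) (touchʳ q)
      }

    conn′ : FibreConnected G c′
    conn′ = merge-connected (merge-connected conn (touch-sym (touchˡ p)))
      (subst₂ (Touch G (merge a i ∘ c)) (merge-here a i) (merge-other λ { refl → fresh p (right∈ p) })
        (touch-map (merge a i) (touchʳ p)))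

    rest : length N ≤ suc t * length Y′
    rest = subst (_≤ suc t * length Y′) (length-map (relabel a b) N)
      (connector-bound k (s≤s⁻¹ (ℕ.≤-trans shorter len)) conn′
        (AllPairs.map⁺ (AllPairs.map⁺ (AllPairs.filter⁺ (¬? ∘ par?) (AllPairs.map⁻ unique))))
        (All.map⁺ (All.tabulate joins′)) ¬minor)

  module _ {Ix : Set} (root : Ix → V) (W : Ix → List V) (spans : ∀ i → Spans (root i) (W i)) where
    open import Data.List.Membership.DecPropositional (_≟_ {n}) using (_∈?_)

    label : List Ix → V → V
    label []       v = v
    label (i ∷ is) v with v ∈? W i
    ... | yes _ = root i
    ... | no  _ = label is v

    label-outside : ∀ {is v} → (∀ {i} → i ∈ is → v ∉ W i) → label is v ≡ v
    label-outside {[]}     _   = refl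
    label-outside {i ∷ is} {v} out with v ∈? W i
    ... | yes v∈ = contradiction v∈ (out (here refl))
    ... | no  _  = label-outside (out ∘ there)

    label-inside : ∀ {is i v} → AllPairs (λ i j → Disjoint (W i) (W j)) is →
                   i ∈ is → v ∈ W i → label is v ≡ root i
    label-inside {i ∷ is} {v = v} (d ∷ ds) i∈ v∈ with v ∈? W i | i∈
    ... | yes v∈W | here refl = refl
    ... | yes v∈W | there i∈′ = contradiction (v∈W , v∈) (All.lookup d i∈′)
    ... | no v∉W  | here refl = contradiction v∈ v∉W
    ... | no v∉W  | there i∈′ = label-inside ds i∈′ v∈

    -- By disjointness, the label of a vertex is itself a vertex of the same fibre, and the vertex
    -- can be reached from it; two vertices with the same label are thus joined through it.
    label-connected : ∀ {is} → AllPairs (λ i j → Disjoint (W i) (W j)) is →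
                      FibreConnected G (label is)
    label-connected {is} disj {u} {v} eq =
      Star.reverse SameFibre-sym (fromLabel u) ◅◅
      subst (λ x → Star (SameFibre G (label is)) x v) (sym eq) (fromLabel v)
      where
      fromLabel : ∀ v → Star (SameFibre G (label is)) (label is v) v
      fromLabel v with Any.any? (λ i → v ∈? W i) is
      ... | no  out = subst (λ x → Star _ x v)
                        (sym (label-outside λ i∈ v∈ → out (lose i∈ v∈))) ε
      ... | yes inn with find inn
      ... | i , i∈ , v∈ = subst (λ x → Star _ x v) (sym (label-inside disj i∈ v∈))
        (Star.map (λ (e , x∈ , y∈) → e , trans (label-inside disj i∈ x∈) (sym (label-inside disj i∈ y∈)))
                  (proj₂ (spans i) v∈))

    -- Contracting each set to its root turns it into a connector. The vertices of `Y` lie in none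
    -- of the sets and keep their own names as labels.
    linking-bound : ∀ {t} {Y is} → AllPairs (λ i j → Disjoint (W i) (W j)) is →
      (∀ i → Disjoint (W i) Y) →
      (a b : Ix → V) → (∀ i → a i ∈ Y) → (∀ i → b i ∈ Y) → (∀ i → a i ≢ b i) →
      (∀ i → ∃[ z ] z ∈ W i × Adj G z (a i)) → (∀ i → ∃[ z ] z ∈ W i × Adj G z (b i)) →
      ¬ HasMinor G (K 2 (suc t)) → length is ≤ suc t * length Y
    linking-bound {t} {Y} {is} disj off a b a∈ b∈ a≢b ta tb ¬minor =
      subst (_≤ suc t * length Y) (length-map _ is)
        (connector-bound (length Y) {E = map (λ i → root i , a i , b i) is} ℕ.≤-refl (label-connected disj)
          (AllPairs.map⁺ (AllPairs.map⁺ (AllPairs.map roots-differ disj)))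
          (All.map⁺ (All.tabulate joins)) ¬minor)
      where
      roots-differ : ∀ {i j} → Disjoint (W i) (W j) → root i ≢ root j
      roots-differ {i} {j} d eq = d (proj₁ (spans i) , subst (_∈ W j) (sym eq) (proj₁ (spans j)))
      touch : ∀ {i y} → i ∈ is → y ∈ Y → (∃[ z ] z ∈ W i × Adj G z y) → Touch G (label is) (root i) y
      touch i∈ y∈ (z , z∈ , e) = z , _ , label-inside disj i∈ z∈ ,
        label-outside {is} (λ {j} _ y∈W → off j (y∈W , y∈)) , e
      joins : ∀ {i} → i ∈ is → Joins (label is) Y (root i , a i , b i)
      joins {i} i∈ = record
        { fresh = λ r∈ → off i (proj₁ (spans i) , r∈)
        ; left∈ = a∈ i ; right∈ = b∈ i ; apart = a≢b i
        ; touchˡ = touch i∈ (a∈ i) (ta i) ; touchʳ = touch i∈ (b∈ i) (tb i) }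

-- Counting the selected vertices

length-cartesianProduct : ∀ {A B : Set} (xs : List A) (ys : List B) →
                          length (cartesianProduct xs ys) ≡ length xs * length ys
length-cartesianProduct []       ys = refl
length-cartesianProduct (x ∷ xs) ys = trans (length-++ (map (x ,_) ys))
  (trans (cong (_+ length (cartesianProduct xs ys)) (length-map (x ,_) ys))
         (cong (length ys +_) (length-cartesianProduct xs ys)))

-- A path has at most `suc k` vertices; the first walk adds at most `k` and the second at most
-- `k + k`. In the second stage a vertex meets at most one set and `linking-bound` supplies the
-- factor `t`. In the first stage a vertex lies on at most `suc k` paths, and the `suc` in
-- `suc bound₂` pays for the bad sets.
module Sizes (t k : ℕ) where
  size₁ = suc k + k
  size₂ = size₁ + (k + k)
  bound₂ = growthBound 1 t size₂ (k + k)
  bound₁ = growthBound (suc k) (suc bound₂) size₁ k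

module Counting {n} (G : Graph n) (t k : ℕ) (¬minor : ¬ HasMinor G (K 2 (suc t))) where
  open Walks G
  open Growing G
  open Connectors G
  open Sizes (suc t) k

  abstract
    ball? : ∀ u v → Dec (Ball k u v)
    ball? u v = map′ within⇒ball ball⇒within (within? G k u v)

  Covers : V → V → Set
  Covers u v = ∀ z → Ball k v z → Ball k u z

  -- The selection rule enters the count through these properties alone, so neither ball sizes nor
  -- identifiers occur below.
  module _ (w : V → V) (w∈ball : ∀ v → Ball k v (w v))
           (w-unique : ∀ {u v} → Ball k u (w v) → Ball k v (w u) → w u ≡ w v)
           (w-escape : ∀ {u v} → Ball k v u → ¬ Covers (w v) u → ∃[ z ] Ball k (w v) z × ¬ Ball k u z)
           where

    path : ∀ v → FreeWalk (proj₁ (w∈ball v)) v (w v)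
    path v = proj₂ (proj₂ (w∈ball v))

    start∈ : ∀ {l u v} (p : FreeWalk l u v) → u ∈ vertices p
    start∈ (stop _)     = here refl
    start∈ (step _ _ _) = there (here refl)

    vertices-spanned : ∀ {l u v} (p : FreeWalk l u v) → Spans u (vertices p)
    vertices-spanned {u = u} {v} p = start∈ p , reach
      where
      reach : ∀ {x} → x ∈ vertices p → Star (Inside (vertices p)) u x
      reach (there x∈) = reaches-initial p there x∈
      reach (here refl) with last-edge p
      ... | inj₁ refl         = ε
      ... | inj₂ (z , z∈ , e) = reaches-initial p there z∈ ◅◅ (e , there z∈ , here refl) ◅ ε

    -- Two different paths cannot contain the same vertex at the same distance
    -- from their starts: otherwise each start would see the other end.
    path-hits : ∀ {vs} Y → AllPairs (λ u v → w u ≢ w v) vs →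
                All (λ v → Meets (vertices (path v)) Y) vs → length vs ≤ suc k * length Y
    path-hits {vs} Y distinct meets = begin
      length vs                                        ≤⟨ pigeon distinct (All.map positions meets) clash ⟩
      length (cartesianProduct (upTo (suc k)) Y)       ≡⟨ length-cartesianProduct (upTo (suc k)) Y ⟩
      length (upTo (suc k)) * length Y                 ≡⟨ cong (_* length Y) (length-upTo (suc k)) ⟩
      suc k * length Y                                 ∎
      where
      open ℕ.≤-Reasoning
      At : V → ℕ × V → Set
      At v (a , y) = FreeWalk a v y × ∃[ b ] FreeWalk b y (w v) × a + b ≤ k
      positions : ∀ {v} → Meets (vertices (path v)) Y → Any (At v) (cartesianProduct (upTo (suc k)) Y)
      positions {v} m with find m
      ... | y , y∈p , y∈Y with splitAt-vertex (path v) y∈p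
      ... | a , b , p₁ , p₂ , eq = lose (∈-cartesianProduct⁺ (∈-upTo⁺ (s≤s (ℕ.≤-trans (ℕ.m≤m+n a b) le))) y∈Y)
                                        (p₁ , b , p₂ , le)
        where le = ℕ.≤-trans (ℕ.≤-reflexive eq) (proj₁ (proj₂ (w∈ball v)))
      clash : ∀ {u v ay} → At u ay → At v ay → ¬ (w u ≢ w v)
      clash (p₁ , b , p₂ , le) (p₁′ , b′ , p₂′ , le′) ne =
        ne (w-unique (_ , le′ , p₁ ++ʷ p₂′) (_ , le , p₁′ ++ʷ p₂))

    paths : Family V
    paths = record
      { root = λ v → v ; set = λ v → vertices (path v) ; spans = λ v → vertices-spanned (path v)
      ; Ok = λ _ _ → Unit ; Distinct = λ u v → w u ≢ w v ; m = suc k ; hits = path-hits }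

    module _ (X : List V) (dominating : ∀ v → ∃[ x ] x ∈ X × Ball k v x) where

      -- `Z` is left general because the first stage replaces `X` by ever larger sets.
      module SecondStage (Z : List V) (X⊆Z : ∀ {v} → v ∈ X → v ∈ Z) where

        Attached : Set
        Attached = ∃ (Grown paths size₁ Z)

        -- Forbidding the first target forces the second attachment to a different vertex.
        -- Disjointness lets a vertex meet at most one set, hence `m = 1`.
        attachments : Family Attached
        attachments = record
          { root = proj₁ ; set = λ (_ , g) → grown g ; spans = λ (_ , g) → spanned g
          ; Ok = λ (_ , g) v → v ≢ target g ; Distinct = Apart paths ; m = 1
          ; hits = λ Y apart meets → ℕ.≤-trans
              (pigeon {R = λ (_ , g) y → y ∈ grown g} apart (All.map meets-sym meets)
                      (λ y∈g y∈h disj → disj (y∈g , y∈h)))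
              (ℕ.≤-reflexive (sym (ℕ.*-identityˡ (length Y)))) }

        -- The only reason why the target may separate an attached set from X.
        Bad : Attached → Set
        Bad (v , g) = Ball k v (target g) × Covers (w v) (target g)

        bad? : Unary.Decidable Bad
        bad? (v , g) = ball? v (target g) ×-dec
                       all? λ z → ball? (target g) z →-dec ball? (w v) z

        wv∈ : ∀ ((v , g) : Attached) → w v ∈ grown g
        wv∈ (v , g) = contains g (here refl)

        At : Attached → V → Set
        At (v , _) y = Ball k v y × Covers (w v) y

        -- A vertex of `Z` is the target of at most one bad set. If `u` and `v` shared it, both
        -- would lie in its ball, hence in the balls of `w v` and `w u`; then `w u ≡ w v` would lie
        -- in two disjoint sets.
        bad-bound : ∀ {gs} → AllPairs (Apart paths) gs → All Bad gs → length gs ≤ length Z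
        bad-bound apart bad = pigeon {R = At} apart (All.map (λ {g} → at-target {g}) bad) λ {g} {h} → clash {g} {h}
          where
          at-target : ∀ {g} → Bad g → Any (At g) Z
          at-target {_ , g} b = lose (target∈ g) b
          clash : ∀ {g h y} → At g y → At h y → ¬ Apart paths g h
          clash {u , g} {v , h} (bu , cu) (bv , cv) disj =
            disj (wv∈ (u , g) , subst (_∈ grown h) (sym same) (wv∈ (v , h)))
            where
            same : w u ≡ w v
            same = w-unique (ball-sym (cv u (ball-sym bu))) (ball-sym (cu v (ball-sym bv)))

        -- A vertex on a walk of length at most `k` is within `k` of both ends, so being far from
        -- one end keeps `p` off the walk.
        avoiding : ∀ {l u v p} → l ≤ k → (¬ Ball k u p) ⊎ (¬ Ball k p v) → FreeWalk l u v → Walk (_≢ p) l u v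
        avoiding l≤k (inj₁ far) q = restrict q λ { {a} {b} q₁ q₂ eq refl →
          far (a , ℕ.≤-trans (ℕ.m≤m+n a b) (ℕ.≤-trans (ℕ.≤-reflexive eq) l≤k) , q₁) }
        avoiding l≤k (inj₂ far) q = restrict q λ { {a} {b} q₁ q₂ eq refl →
          far (b , ℕ.≤-trans (ℕ.m≤n+m b a) (ℕ.≤-trans (ℕ.≤-reflexive eq) l≤k) , q₂) }

        -- If `v` is near the target, the walk starts at `w v` instead and runs to `X` through a
        -- vertex `z` outside the ball of the target. Being far from `z` keeps the target off both
        -- halves, whose lengths add up to at most `k + k`.
        reach : ∀ {g} → ¬ Bad g → Reach attachments (k + k) Z g
        reach {v , g} ¬bad = go (ball? v (target g))
          where
          p = target g
          go : Dec (Ball k v p) → Reach attachments (k + k) Z (v , g)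
          go (no far) with dominating v
          ... | x , x∈ , l , l≤k , q = v , proj₁ (spanned g) , x , X⊆Z x∈ , l ,
                ℕ.≤-trans l≤k (ℕ.m≤m+n k k) , avoiding l≤k (inj₁ far) q
          go (yes near) with w-escape near (λ c → ¬bad (near , c))
          ... | z , (a , a≤k , q₁) , far with dominating z
          ... | x , x∈ , b , b≤k , q₂ = w v , wv∈ (v , g) , x , X⊆Z x∈ , a + b , ℕ.+-mono-≤ a≤k b≤k ,
                avoiding a≤k (inj₂ far) q₁ ++ʷ avoiding b≤k (inj₁ (far ∘ ball-sym)) q₂

        attached-bound : (gs : List Attached) → AllPairs (Apart paths) gs → length gs ≤ suc bound₂ * length Z
        attached-bound gs apart = begin
          length gs                                        ≡⟨ length-partition bad? gs ⟩
          length (filter bad? gs) + length (filter good? gs)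
            ≤⟨ ℕ.+-mono-≤ (bad-bound (AllPairs.filter⁺ bad? apart) (All.all-filter bad? gs)) good ⟩
          length Z + bound₂ * length Z                     ∎
          where
          open ℕ.≤-Reasoning
          good? = ¬? ∘ bad?
          good : length (filter good? gs) ≤ bound₂ * length Z
          good = family-bound attachments (k + k) Z
            (λ (_ , g) → ℕ.+-monoˡ-≤ (k + k) (size g))
            (AllPairs.filter⁺ good? apart)
            (All.map (λ {g} ¬bad → inj₂ (reach {g} ¬bad)) (All.all-filter good? gs))
            -- Sets that have grown twice are connectors: the first target and the second one are
            -- different vertices of `Y`.
            λ Y Z⊆Y hs disj → linking-bound (proj₁ ∘ proj₁) (λ (_ , h) → grown h) (λ (_ , h) → spanned h) disj
              (λ (_ , h) → avoids h)
              (λ ((_ , g) , _) → target g) (λ (_ , h) → target h)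
              (λ ((_ , g) , _) → Z⊆Y (target∈ g)) (λ (_ , h) → target∈ h)
              (λ (_ , h) → ≢-sym (target-ok h))
              (λ ((_ , g) , h) → source g , contains h (source∈ g) , attached g)
              (λ (_ , h) → source h , source∈ h , attached h)
              ¬minor

      selection-bound : ∀ {vs} → AllPairs (λ u v → w u ≢ w v) vs → length vs ≤ bound₁ * length X
      selection-bound distinct = family-bound paths k X
        (λ v → ℕ.+-monoˡ-≤ k (s≤s (ℕ.≤-trans (ℕ.≤-reflexive (length-initial (path v))) (proj₁ (proj₂ (w∈ball v))))))
        distinct
        (All.tabulate λ {v} _ → let x , x∈ , l , l≤k , q = dominating v in
          inj₂ (v , proj₁ (vertices-spanned (path v)) , x , x∈ , l , l≤k , q))
        λ Z X⊆Z → SecondStage.attached-bound Z X⊆Z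

-- Properties of DomSet

elements : Subset n → List (Fin n)
elements []            = []
elements (inside ∷ S)  = zero ∷ map suc (elements S)
elements (outside ∷ S) = map suc (elements S)

elements⁺ : ∀ {S : Subset n} {x} → x ∈ₛ S → x ∈ elements S
elements⁺                       here       = here refl
elements⁺ {S = inside ∷ _}  (there x∈) = there (∈-map⁺ suc (elements⁺ x∈))
elements⁺ {S = outside ∷ _} (there x∈) = ∈-map⁺ suc (elements⁺ x∈)

elements⁻ : ∀ {S : Subset n} {x} → x ∈ elements S → x ∈ₛ S
elements⁻ {S = inside ∷ _} (here refl) = here
elements⁻ {S = inside ∷ _} (there x∈) with ∈-map⁻ suc x∈
... | _ , y∈ , refl = there (elements⁻ y∈)
elements⁻ {S = outside ∷ _} x∈ with ∈-map⁻ suc x∈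
... | _ , y∈ , refl = there (elements⁻ y∈)

elements-unique : (S : Subset n) → Unique (elements S)
elements-unique []            = []
elements-unique (inside ∷ S)  = All.tabulate zero≢ ∷ Unique.map⁺ suc-injective (elements-unique S)
  where
  zero≢ : ∀ {x} → x ∈ map suc (elements S) → zero ≢ x
  zero≢ x∈ refl with ∈-map⁻ suc x∈
  ... | _ , _ , ()
elements-unique (outside ∷ S) = Unique.map⁺ suc-injective (elements-unique S)

length-elements : (S : Subset n) → length (elements S) ≡ ∣ S ∣
length-elements []            = refl
length-elements (inside ∷ S)  = cong suc (trans (length-map suc (elements S)) (length-elements S))
length-elements (outside ∷ S) = trans (length-map suc (elements S)) (length-elements S)

∉⇒lookup : ∀ {S : Subset n} {x} → x ∉ₛ S → Vec.lookup S x ≡ outside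
∉⇒lookup {S = S} {x} x∉ with Vec.lookup S x in eq
... | inside  = contradiction (lookup⇒[]= x S eq) x∉
... | outside = refl

⋃-singletons⁺ : ∀ {A : Set} (f : A → Fin n) {x xs} → x ∈ xs → f x ∈ₛ ⋃ (map (⁅_⁆ ∘ f) xs)
⋃-singletons⁺ f (here refl) = x∈p∪q⁺ (inj₁ (x∈⁅x⁆ _))
⋃-singletons⁺ f (there x∈)  = x∈p∪q⁺ (inj₂ (⋃-singletons⁺ f x∈))

⋃-singletons⁻ : ∀ {A : Set} (f : A → Fin n) {y} xs → y ∈ₛ ⋃ (map (⁅_⁆ ∘ f) xs) → ∃[ x ] f x ≡ y
⋃-singletons⁻ f []       y∈ = contradiction y∈ ∉⊥
⋃-singletons⁻ f (x ∷ xs) y∈ with x∈p∪q⁻ ⁅ f x ⁆ _ y∈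
... | inj₁ y∈x  = x , sym (x∈⁅y⁆⇒x≡y (f x) y∈x)
... | inj₂ y∈xs = ⋃-singletons⁻ f xs y∈xs

private
  module E = Extrema (×-totalOrder ℕ.≤-decTotalOrder ℕ.≤-totalOrder)

module Lex = TotalOrder (×-totalOrder ℕ.≤-decTotalOrder ℕ.≤-totalOrder)

Lex-proj₁ : ∀ {x y} → x Lex.≤ y → proj₁ x ≤ proj₁ y
Lex-proj₁ (inj₁ (le , _)) = le
Lex-proj₁ (inj₂ (eq , _)) = ℕ.≤-reflexive eq

module DomSetProperties (k : ℕ) (G : Graph n) (ID : Fin n → ℕ) where
  open DomSet k G ID
  open Walks G
  private
    N : Fin n → Subset n
    N = N[_] G k

    rank : Fin n → ℕ × ℕ
    rank u = q u , ID u

  ∈N⁺ : ∀ {u v} → Ball k v u → u ∈ₛ N v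
  ∈N⁺ {u} {v} b = lookup⇒[]= u _
    (trans (lookup∘tabulate _ u) (dec-true (within? G k v u) (ball⇒within b)))

  ∈N⁻ : ∀ {u v} → u ∈ₛ N v → Ball k v u
  ∈N⁻ {u} {v} u∈ = decide (within? G k v u) (trans (sym (lookup∘tabulate _ u)) ([]=⇒lookup u∈))
    where
    decide : (d : Dec (Within G k v u)) → does d ≡ true → Ball k v u
    decide (yes w) _ = within⇒ball w

  w∈ball : ∀ v → Ball k v (w v)
  -- The default of `argmax` is `v`, which lies in its own ball.
  w∈ball v = E.argmax-all rank {P = Ball k v} (within⇒ball (within-refl G k v))
    (All.tabulate λ u∈ → ∈N⁻ (proj₂ (∈-filter⁻ (_∈ₛ? N v) {xs = allFin n} u∈)))

  w-max : ∀ {u v} → Ball k v u → rank u Lex.≤ rank (w v)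
  w-max {u} {v} b = All.lookup (E.f[xs]≤f[argmax] {f = rank} v _) (∈-filter⁺ (_∈ₛ? N v) (∈-allFin u) (∈N⁺ b))

  q-max : ∀ {u v} → Ball k v u → q u ≤ q (w v)
  q-max b = Lex-proj₁ (w-max b)

  -- Each of the two selections was a candidate for the other selector, so their ranks agree, and
  -- with them the identifiers.
  w-unique : Injective _≡_ _≡_ ID → ∀ {u v} → Ball k u (w v) → Ball k v (w u) → w u ≡ w v
  w-unique ID-inj bu bv = ID-inj (proj₂ (Lex.antisym (w-max bv) (w-max bu)))

  w∈D : ∀ v → w v ∈ₛ D
  w∈D v = ⋃-singletons⁺ w (∈-allFin v)

  D⁻ : ∀ {x} → x ∈ₛ D → ∃[ v ] w v ≡ x
  D⁻ = ⋃-singletons⁻ w (allFin n)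

  D-dominating : Dominating G k D
  D-dominating v = w v , w∈D v , ball⇒within (w∈ball v)

  -- If nothing escapes, `N v` is contained in `N u`; as it is at least as large, the inclusion
  -- cannot be strict.
  escape-or-⊆ : ∀ u v → q u ≤ q v → (∃[ z ] z ∈ₛ N v × z ∉ₛ N u) ⊎ N u ⊆ N v
  escape-or-⊆ u v qu≤qv with any? (λ z → z ∈ₛ? N v ×-dec ¬? (z ∈ₛ? N u))
  ... | yes found = inj₁ found
  ... | no  none  = inj₂ sub
    where
    rev : N v ⊆ N u
    rev {z} z∈ with z ∈ₛ? N u
    ... | yes z∈u = z∈u
    ... | no  z∉u = contradiction (z , z∈ , z∉u) none
    sub : N u ⊆ N v
    sub {z} z∈ with z ∈ₛ? N v
    ... | yes z∈v = z∈v
    ... | no  z∉v = contradiction (p⊂q⇒∣p∣<∣q∣ (rev , z , z∈ , z∉v)) (ℕ.≤⇒≯ qu≤qv)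

-- The LOCAL algorithm

countDistinct : List ℕ → ℕ
countDistinct = length ∘ deduplicate ℕ._≟_

-- Makes `(0 , 0)` a harmless default for `best`.
zero-least : ∀ x → (0 , 0) Lex.≤ x
zero-least (zero  , _) = inj₂ (refl , z≤n)
zero-least (suc _ , _) = inj₁ (z≤n , λ ())

abstract
  best : List (ℕ × ℕ) → ℕ × ℕ
  best = E.max (0 , 0)

  best-max : ∀ {x xs} → x ∈ xs → All (Lex._≤ x) xs → proj₂ (best xs) ≡ proj₂ x
  best-max {x} {xs} x∈ below = proj₂ (Lex.antisym {best xs} {x}
    (E.max≤v⁺ {xs = xs} (zero-least x) below)
    (E.v≤max⁺ (0 , 0) xs (inj₂ (lose x∈ Lex.refl))))

record Memory : Set where
  constructor memory
  field
    round    : ℕ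
    ident    : ℕ
    idents   : List ℕ
    ranks    : List (ℕ × ℕ)
    selected : List ℕ

open Memory

gather : {A : Set} → (Memory → List A) → Memory → List Memory → List A
gather f s ms = f s ++ concatMap f ms

-- The rank and the vote are provisional and recomputed in every round of the first flood, so that
-- the second flood starts from the right rank without a round of its own.
measured : ℕ → ℕ → List ℕ → Memory
measured r i is = memory r i is [ countDistinct is , i ] [ proj₂ (best [ countDistinct is , i ]) ]

voted : ℕ → ℕ → List ℕ → List (ℕ × ℕ) → Memory
voted r i is rs = memory r i is rs [ proj₂ (best rs) ]

update : ℕ → Memory → List Memory → Memory
update k s ms =
  if does (round s <? k) then
    measured (suc (round s)) (ident s) (gather idents s ms)
  else if does (round s <? k + k) then
    voted (suc (round s)) (ident s) (idents s) (gather ranks s ms)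
  else
    memory (suc (round s)) (ident s) (idents s) (ranks s) (gather selected s ms)

-- Three floods of k rounds each: of the identifiers, which gives the ball
-- sizes, of the pairs (ball size , identifier), and of the selected identifiers.
domSet : ℕ → LocalAlgorithm Result
domSet k = record
  { State   = λ _ → Memory
  ; Message = Memory
  ; init    = λ _ i → measured 0 i [ i ]
  ; send    = λ s _ → s
  ; receive = λ s ms → update k s (tabulate ms)
  ; rounds  = k + (k + k)
  ; output  = λ s → result (countDistinct (idents s)) (proj₂ (best (ranks s)))
                           (does (ident s ∈ℕ? selected s))
  }

-- Correctness of the distributed algorithm.

module Correctness (k : ℕ) {n} {G : Graph n} (net : Network G) where
  open Network net
  open Walks G
  open DomSet k G ID
  open DomSetProperties k G ID

  nbrs : Fin n → List (Fin n)
  nbrs v = tabulate (nbr v)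

  -- Flooding without the bookkeeping of `Memory`: after `r` rounds a vertex holds the entries of
  -- exactly the vertices in its ball of radius `r`, possibly with repetitions.
  flood : {A : Set} → (Fin n → List A) → ℕ → Fin n → List A
  flood f zero    v = f v
  flood f (suc r) v = flood f r v ++ concatMap (flood f r) (nbrs v)

  module _ {A : Set} {f : Fin n → List A} {x : A} where

    flood⁻ : ∀ r {v} → x ∈ flood f r v → ∃[ u ] Ball r v u × x ∈ f u
    flood⁻ zero    {v} x∈ = v , (0 , z≤n , stop′) , x∈
    flood⁻ (suc r) {v} x∈ with ∈-++⁻ (flood f r v) x∈
    ... | inj₁ x∈v = let u , (l , l≤r , p) , x∈u = flood⁻ r x∈v in u , (l , ℕ.m≤n⇒m≤1+n l≤r , p) , x∈u
    ... | inj₂ x∈c with find (∈-concatMap⁻ (flood f r) {xs = nbrs v} x∈c)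
    ... | y , y∈ , x∈y with ∈-tabulate⁻ y∈ | flood⁻ r x∈y
    ... | i , refl | u , (l , l≤r , p) , x∈u = u , (suc l , s≤s l≤r , step′ (nbr-adj v i) p) , x∈u

    flood⁺ : ∀ r {v u} → Ball r v u → x ∈ f u → x ∈ flood f r v
    flood⁺ zero    (_ , z≤n , stop _) x∈ = x∈
    flood⁺ (suc r) (_ , _ , stop _)   x∈ = ∈-++⁺ˡ (flood⁺ r (0 , z≤n , stop′) x∈)
    flood⁺ (suc r) {v} (_ , s≤s l≤r , step _ e p) x∈ = ∈-++⁺ʳ (flood f r v)
      (∈-concatMap⁺ (flood f r) (lose (subst (_∈ nbrs v) (nbr-port e) (∈-tabulate⁺ (port e)))
                                      (flood⁺ r (_ , l≤r , p) x∈)))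

  gather-flood : {A : Set} {f : Fin n → List A} (field′ : Memory → List A) (M : Fin n → Memory) {r : ℕ} →
                 (∀ v → field′ (M v) ≡ flood f r v) →
                 ∀ v → gather field′ (M v) (map M (nbrs v)) ≡ flood f (suc r) v
  gather-flood field′ M eq v = cong₂ _++_ (eq v)
    (cong concat (trans (sym (map-∘ (nbrs v))) (map-cong eq (nbrs v))))

  states : ℕ → Fin n → Memory
  states = stateAfter (domSet k) net

  -- Every vertex sends its whole memory through each port, so a round depends only on the memories
  -- of the neighbours.
  next : ∀ {r} {M : Fin n → Memory} → (∀ v → states r v ≡ M v) →
         ∀ v → states (suc r) v ≡ update k (M v) (map M (nbrs v))
  next {r} {M} eq v = cong₂ (update k) (eq v)
    (trans (sym (map-tabulate (nbr v) (states r))) (map-cong eq (nbrs v)))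

  idsAt : ℕ → Fin n → List ℕ
  idsAt = flood λ v → [ ID v ]

  ranksAt : ℕ → Fin n → List (ℕ × ℕ)
  ranksAt = flood λ v → [ countDistinct (idsAt k v) , ID v ]

  selectedAt : ℕ → Fin n → List ℕ
  selectedAt = flood λ v → [ proj₂ (best (ranksAt k v)) ]

  phase₁ : ∀ r → r ≤ k → ∀ v → states r v ≡ measured r (ID v) (idsAt r v)
  phase₁ zero    _   v = refl
  phase₁ (suc r) r<k v = trans (next {r} {M} (phase₁ r (ℕ.<⇒≤ r<k)) v) step-eq
    where
    M : Fin n → Memory
    M u = measured r (ID u) (idsAt r u)
    step-eq : update k (M v) (map M (nbrs v)) ≡ measured (suc r) (ID v) (idsAt (suc r) v)
    step-eq rewrite dec-true (r <? k) r<k = cong (measured (suc r) (ID v)) (gather-flood idents M {r} (λ _ → refl) v)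

  phase₂ : ∀ r → r ≤ k → ∀ v → states (r + k) v ≡ voted (r + k) (ID v) (idsAt k v) (ranksAt r v)
  -- At the turn of the phases both descriptions agree by computation: `measured` holds just the
  -- vertex's own rank.
  phase₂ zero    _   v = phase₁ k ℕ.≤-refl v
  phase₂ (suc r) r<k v = trans (next {r + k} {M} (phase₂ r (ℕ.<⇒≤ r<k)) v) step-eq
    where
    M : Fin n → Memory
    M u = voted (r + k) (ID u) (idsAt k u) (ranksAt r u)
    step-eq : update k (M v) (map M (nbrs v)) ≡ voted (suc r + k) (ID v) (idsAt k v) (ranksAt (suc r) v)
    step-eq rewrite dec-false (r + k <? k) (ℕ.≤⇒≯ (ℕ.m≤n+m k r))
                  | dec-true (r + k <? k + k) (ℕ.+-monoˡ-< k r<k) =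
      cong (voted (suc r + k) (ID v) (idsAt k v)) (gather-flood ranks M {r} (λ _ → refl) v)

  phase₃ : ∀ r v → states (r + (k + k)) v ≡
                   memory (r + (k + k)) (ID v) (idsAt k v) (ranksAt k v) (selectedAt r v)
  phase₃ zero    v = phase₂ k ℕ.≤-refl v
  phase₃ (suc r) v = trans (next {r + (k + k)} {M} (phase₃ r) v) step-eq
    where
    M : Fin n → Memory
    M u = memory (r + (k + k)) (ID u) (idsAt k u) (ranksAt k u) (selectedAt r u)
    step-eq : update k (M v) (map M (nbrs v)) ≡
              memory (suc r + (k + k)) (ID v) (idsAt k v) (ranksAt k v) (selectedAt (suc r) v)
    step-eq rewrite dec-false (r + (k + k) <? k) (ℕ.≤⇒≯ (ℕ.≤-trans (ℕ.m≤m+n k k) (ℕ.m≤n+m (k + k) r)))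
                  | dec-false (r + (k + k) <? k + k) (ℕ.≤⇒≯ (ℕ.m≤n+m (k + k) r)) =
      cong (memory (suc r + (k + k)) (ID v) (idsAt k v) (ranksAt k v)) (gather-flood selected M {r} (λ _ → refl) v)

  -- Identifiers are injective, so the distinct ones received correspond to the vertices of the
  -- ball.
  count-correct : ∀ v → countDistinct (idsAt k v) ≡ q v
  count-correct v = trans (ℕ.≤-antisym
      (Unique-⊆⇒length≤ (deduplicate-! (idsAt k v)) to)
      (Unique-⊆⇒length≤ (Unique.map⁺ ID-injective (elements-unique (N[_] G k v))) from))
    (trans (length-map ID (elements (N[_] G k v))) (length-elements (N[_] G k v)))
    where
    to : ∀ {x} → x ∈ deduplicate ℕ._≟_ (idsAt k v) → x ∈ map ID (elements (N[_] G k v))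
    to x∈ with flood⁻ k (∈-deduplicate⁻ ℕ._≟_ (idsAt k v) x∈)
    ... | u , b , here refl = ∈-map⁺ ID (elements⁺ (∈N⁺ b))
    from : ∀ {x} → x ∈ map ID (elements (N[_] G k v)) → x ∈ deduplicate ℕ._≟_ (idsAt k v)
    from x∈ with ∈-map⁻ ID x∈
    ... | u , u∈ , refl = ∈-deduplicate⁺ ℕ._≟_ (flood⁺ k (∈N⁻ (elements⁻ u∈)) (here refl))

  best-correct : ∀ v → proj₂ (best (ranksAt k v)) ≡ ID (w v)
  best-correct v = best-max {x = q (w v) , ID (w v)}
    (flood⁺ k (w∈ball v) (here (cong (_, ID (w v)) (sym (count-correct (w v))))))
    (All.tabulate λ x∈ → let u , b , x∈u = flood⁻ k x∈ in below b x∈u)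
    where
    below : ∀ {u x} → Ball k v u → x ∈ [ countDistinct (idsAt k u) , ID u ] → x Lex.≤ (q (w v) , ID (w v))
    below {u} b (here refl) = subst (λ c → (c , ID u) Lex.≤ (q (w v) , ID (w v)))
                                    (sym (count-correct u)) (w-max b)

  -- A selected vertex is within `k` of its selector, so `k` rounds bring it such a vote.
  -- Conversely, injectivity of the identifiers shows that a vote carrying its identifier is meant
  -- for it.
  inD-correct : ∀ v → does (ID v ∈ℕ? selectedAt k v) ≡ Vec.lookup D v
  inD-correct v = go (v ∈ₛ? D)
    where
    go : Dec (v ∈ₛ D) → does (ID v ∈ℕ? selectedAt k v) ≡ Vec.lookup D v
    go (yes v∈D) = trans (dec-true (ID v ∈ℕ? selectedAt k v) chosen) (sym ([]=⇒lookup v∈D))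
      where
      chosen : ID v ∈ selectedAt k v
      chosen = let u , eq = D⁻ v∈D in
        flood⁺ k (ball-sym (subst (Ball k u) eq (w∈ball u)))
                 (here (trans (cong ID (sym eq)) (sym (best-correct u))))
    go (no  v∉D) = trans (dec-false (ID v ∈ℕ? selectedAt k v) unchosen) (sym (∉⇒lookup v∉D))
      where
      unchosen : ¬ ID v ∈ selectedAt k v
      unchosen x∈ with flood⁻ k x∈
      ... | u , _ , here eq = v∉D (subst (_∈ₛ D) (sym (ID-injective (trans eq (best-correct u)))) (w∈D u))

  domSet-correct : ∀ v → run (domSet k) net v ≡ domSetResult k net v
  domSet-correct v = trans (cong (LocalAlgorithm.output (domSet k) {degree v}) (phase₃ k v))
    (trans (cong₂ (λ a b → result a b (does (ID v ∈ℕ? selectedAt k v))) (count-correct v) (best-correct v))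
           (cong (result (q v) (ID (w v))) (inD-correct v)))

-- The approximation bound.

module _ (k t : ℕ) {n} (G : Graph n) (ID : Fin n → ℕ) (ID-inj : Injective _≡_ _≡_ ID)
         (¬minor : ¬ HasMinor G (K 2 (suc t))) where
  open DomSet k G ID using (q; w; D)
  open DomSetProperties k G ID
  open Walks G
  open Counting G t k ¬minor

  -- As `u` was a candidate for `v`, the ball of `w v` is at least as large as that of `u`; not
  -- containing it, it has a vertex outside it.
  w-escape : ∀ {u v} → Ball k v u → ¬ Covers (w v) u → ∃[ z ] Ball k (w v) z × ¬ Ball k u z
  w-escape {u} {v} b ¬covers = go (escape-or-⊆ u (w v) (q-max b))
    where
    go : _ → ∃[ z ] Ball k (w v) z × ¬ Ball k u z
    go (inj₁ (z , z∈ , z∉)) = z , ∈N⁻ z∈ , z∉ ∘ ∈N⁺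
    go (inj₂ Nu⊆Nw)         = contradiction (λ z bz → ∈N⁻ (Nu⊆Nw (∈N⁺ bz))) ¬covers

  D-bound : ∀ {X : Subset n} → Dominating G k X → ∣ D ∣ ≤ Sizes.bound₁ (suc t) k * ∣ X ∣
  D-bound {X} dom = subst₂ (λ d x → d ≤ Sizes.bound₁ (suc t) k * x)
    length-vs (length-elements X)
    (selection-bound w w∈ball (w-unique ID-inj) w-escape (elements X)
      (λ v → let x , x∈ , near = dom v in x , elements⁺ x∈ , within⇒ball near)
      distinct)
    where
    -- One selector for each element of `D`; different elements give selectors with different
    -- selections.
    selectors : All (λ x → ∃[ v ] w v ≡ x) (elements D)
    selectors = All.tabulate (D⁻ ∘ elements⁻)
    pairs = All.toList selectors
    length-vs : length (map (proj₁ ∘ proj₂) pairs) ≡ ∣ D ∣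
    length-vs = trans (length-map _ pairs) (trans (sym (length-map proj₁ pairs))
      (trans (cong length (map-proj₁-toList selectors)) (length-elements D)))
    distinct : AllPairs (λ u v → w u ≢ w v) (map (proj₁ ∘ proj₂) pairs)
    distinct = AllPairs.map⁺ (AllPairs.map
      (λ { {_ , u , eq} {_ , v , eq′} ne same → ne (trans (sym eq) (trans same eq′)) })
      (AllPairs.map⁻ (subst Unique (sym (map-proj₁-toList selectors)) (elements-unique D))))

theorem15 : Σ[ c ∈ ℕ ] Σ[ A ∈ (ℕ → LocalAlgorithm Result) ]
    ((t k : ℕ) .{{_ : NonZero t}} .{{_ : NonZero k}} →
    Σ[ δ ∈ ℕ ]
    (∀ {n} (G : Graph n) (net : Network G) →
    Connected G →
    ¬ HasMinor G (K 2 t) →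
    ∃[ d ] (Diameter G d × 4 * k ≤ d) →
    let D = DomSet.D k G (Network.ID net) in
    LocalAlgorithm.rounds (A k) ≤ c * k ×
    (∀ v → run (A k) net v ≡ domSetResult k net v) ×
    Dominating G k D ×
    ∣ D ∣ ≤ δ * γ G k))
-- Three floods of `k` rounds each give the factor `3`.
theorem15 = 3 , domSet , λ { (suc t) k → Sizes.bound₁ (suc t) k , λ G net _ ¬minor _ →
  ℕ.≤-reflexive (cong (λ x → k + (k + x)) (sym (ℕ.+-identityʳ k))) ,
  Correctness.domSet-correct k net ,
  DomSetProperties.D-dominating k G (Network.ID net) ,
  D-bound-γ t k G net ¬minor }
  where
  D-bound-γ : ∀ t k {n} (G : Graph n) (net : Network G) → ¬ HasMinor G (K 2 (suc t)) →
              ∣ DomSet.D k G (Network.ID net) ∣ ≤ Sizes.bound₁ (suc t) k * γ G k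
  D-bound-γ t k G net ¬minor = let (X , dom , size) , _ = proj₂ (minimumDominating G k) in
    subst (λ s → ∣ DomSet.D k G (Network.ID net) ∣ ≤ Sizes.bound₁ (suc t) k * s) size
          (D-bound k t G (Network.ID net) (Network.ID-injective net) ¬minor dom)
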